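{- Let $M$ be a matroid of rank $r$ on a finite set $E$ and let $I_M$ be its independent set polytope. Then, as a signed Minkowski sum, \[I_M=\sum_{A\subseteq E}\widetilde\beta(M/A)\,D_{E-A},\] i.e. $I_M+\sum_{A:\,\widetilde\beta(M/A)<0}(-\widetilde\beta(M/A))D_{E-A}=\sum_{A:\,\widetilde\beta(M/A)>0}\widetilde\beta(M/A)D_{E-A}$.
   Context: The independent set polytope $I_M\subseteq\mathbb{R}^E$ is the convex hull of the indicator vectors of the independent sets of $M$. For $J\subseteq E$, $D_J=\mathrm{conv}(\{0\}\cup\{e_i:i\in J\})$. For $A\subseteq E$, $M/A$ is the contraction with rank function $r_{M/A}(X)=r(X\cup A)-r(A)$ on $E-A$. For a matroid $N$ on $S$, $\beta(N)=(-1)^{r_N(S)}\sum_{X\subseteq S}(-1)^{|X|}r_N(X)$ and $\widetilde\beta(N)=(-1)^{r_N(S)+1}\beta(N)$. Minkowski sum $P+Q=\{p+q\}$, $yQ=\{yq\}$ for $y\ge0$.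
   Formalization: The polytopes are taken in ℚ^E rather than ℝ^E: points and convex-combination coefficients are rational, and the equality is proved for rational points (all the polytopes have integral vertices). -}

module Defs where

open import Data.Nat as ℕ using (ℕ; zero; suc; _∸_)
open import Data.Integer as ℤ using (ℤ; +_)
import Data.Integer.Properties as ℤP
open import Data.Rational as ℚ using (ℚ; 0ℚ; 1ℚ)
open import Data.Fin using (Fin; zero; suc)
open import Data.Fin.Subset using (Subset; inside; outside; _⊆_; _∪_; _∩_; ∣_∣; ∁; ⊥; ⊤)
open import Data.Fin.Subset.Properties using (_⊆?_)
open import Data.Bool using (if_then_else_)
open import Data.Vec using (Vec; []; _∷_; lookup)
open import Data.List as List using (List; []; _∷_; _++_; length; filter; map; concatMap; allFin)
open import Data.Product using (Σ; _×_; ∃; _,_)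
open import Relation.Binary.PropositionalEquality using (_≡_)
open import Relation.Nullary using (Dec; yes; no)
open import Data.Nat using (_≟_)

record Matroid (n : ℕ) : Set where
  field
    r          : Subset n → ℕ
    r-bounded  : ∀ X → r X ℕ.≤ ∣ X ∣
    r-mono     : ∀ {X Y} → X ⊆ Y → r X ℕ.≤ r Y
    r-submod   : ∀ X Y → r (X ∪ Y) ℕ.+ r (X ∩ Y) ℕ.≤ r X ℕ.+ r Y

open Matroid public

allSubsets : ∀ n → List (Subset n)
allSubsets zero    = [] ∷ []
allSubsets (suc n) = concatMap (λ s → (outside ∷ s) ∷ (inside ∷ s) ∷ []) (allSubsets n)

Independent : ∀ {n} → Matroid n → Subset n → Set
Independent M X = r M X ≡ ∣ X ∣

independent? : ∀ {n} (M : Matroid n) (X : Subset n) → Dec (Independent M X)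
independent? M X = r M X ≟ ∣ X ∣

-- Beta invariant of a matroid N on S ⊆ E given by a rank function ρ
-- (defined on subsets of S; we only evaluate it on subsets of S).

sumℤ : List ℤ → ℤ
sumℤ = List.foldr ℤ._+_ (+ 0)

sign : ℕ → ℤ
sign k = (ℤ.- (+ 1)) ℤ.^ k

β : ∀ {n} (S : Subset n) (ρ : Subset n → ℕ) → ℤ
β {n} S ρ = sign (ρ S) ℤ.* sumℤ (map (λ X → sign ∣ X ∣ ℤ.* + ρ X) (filter (_⊆? S) (allSubsets n)))

β̃ : ∀ {n} (S : Subset n) (ρ : Subset n → ℕ) → ℤ
β̃ S ρ = sign (suc (ρ S)) ℤ.* β S ρ

contractRank : ∀ {n} → Matroid n → Subset n → Subset n → ℕ
contractRank M A X = r M (X ∪ A) ∸ r M A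

β̃/ : ∀ {n} → Matroid n → Subset n → ℤ
β̃/ M A = β̃ (∁ A) (contractRank M A)

Point : ℕ → Set
Point n = Fin n → ℚ

_≈ᵖ_ : ∀ {n} → Point n → Point n → Set
x ≈ᵖ y = ∀ i → x i ≡ y i

PSet : ℕ → Set₁
PSet n = Point n → Set

sumFin : ∀ m → (Fin m → ℚ) → ℚ
sumFin zero    f = 0ℚ
sumFin (suc m) f = f zero ℚ.+ sumFin m (λ k → f (suc k))

conv : ∀ {n} → List (Point n) → PSet n
conv ps x = Σ (Fin (length ps) → ℚ) λ w →
  (∀ k → 0ℚ ℚ.≤ w k) × (sumFin _ w ≡ 1ℚ) ×
  (∀ i → x i ≡ sumFin _ (λ k → w k ℚ.* List.lookup ps k i))

indicator : ∀ {n} → Subset n → Point n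
indicator X i = if lookup X i then 1ℚ else 0ℚ

zeroPt : ∀ {n} → Point n
zeroPt _ = 0ℚ

IM : ∀ {n} → Matroid n → PSet n
IM {n} M = conv (map indicator (filter (independent? M) (allSubsets n)))

basis : ∀ {n} → Fin n → Point n
basis i j with i Data.Fin.≟ j
  where import Data.Fin
... | yes _ = 1ℚ
... | no  _ = 0ℚ

D : ∀ {n} → Subset n → PSet n
D {n} J = conv (zeroPt ∷ map basis (filter (λ i → Data.Bool._≟_ (lookup J i) inside) (allFin n)))
  where import Data.Bool

_⊕_ : ∀ {n} → PSet n → PSet n → PSet n
(P ⊕ Q) x = Σ _ λ p → Σ _ λ q → P p × Q q × (x ≈ᵖ (λ i → p i ℚ.+ q i))

_·_ : ∀ {n} → ℚ → PSet n → PSet n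
(y · Q) x = Σ _ λ q → Q q × (x ≈ᵖ (λ i → y ℚ.* q i))

Zero : ∀ {n} → PSet n
Zero x = x ≈ᵖ zeroPt

⨁ : ∀ {n} → List (PSet n) → PSet n
⨁ = List.foldr _⊕_ Zero

toℚ : ℤ → ℚ
toℚ z = z ℚ./ 1

negativeSide : ∀ {n} → Matroid n → PSet n
negativeSide {n} M = ⨁ (map (λ A → toℚ (ℤ.- β̃/ M A) · D (∁ A))
  (filter (λ A → β̃/ M A ℤP.<? + 0) (allSubsets n)))

positiveSide : ∀ {n} → Matroid n → PSet n
positiveSide {n} M = ⨁ (map (λ A → toℚ (β̃/ M A) · D (∁ A))
  (filter (λ A → + 0 ℤP.<? β̃/ M A) (allSubsets n)))

{-# OPTIONS --safe #-}
module Submission where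

-- Adjoin to E a slack element 0 and let F be a submodular function on the subsets of E ∪ {0}.
-- Every point x of the base polytope of F is a convex combination of its greedy vertices: while
-- two elements i, j are not separated by a chain of x-tight sets, push x in the directions
-- ±(eᵢ - eⱼ) until a set separating them becomes tight, and refine the chain by uncrossing.
-- Greedy vertices are additive in F, so a Minkowski sum of projected base polytopes is the projected
-- base polytope of the sum.  I_M and D_J are the projections for K ↦ r(K) (with value r(E) when
-- 0 ∈ K) and K ↦ [K meets J ∪ {0}], and Möbius inversion gives
-- Σ_A β̃(M/A) [K meets (E - A) ∪ {0}] = r(K), so both sides of the theorem come from the same F.

open import Defs
open import Data.Bool as Bool using (Bool; true; false; not; if_then_else_; _∨_; _∧_)
open import Data.Bool.Properties using (∨-identityʳ; ∧-zeroʳ; ∧-identityʳ)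
open import Data.Fin as Fin using (Fin; zero; suc)
import Data.Fin.Properties as FinP
open import Data.Fin.Subset as Subset using (Subset; inside; outside; _⊆_; _∪_; _∩_; ∁; ⊥; ⊤; ⁅_⁆; ∣_∣)
open import Data.Fin.Subset.Properties
  using (_∈?_; _⊆?_; x∈p∪q⁻; x∈p∪q⁺; x∈p∩q⁺; x∈p∩q⁻; x∉p⇒x∈∁p; q⊆p∪q; p∩q⊆q; p∩q⊆p; ∣⁅x⁆∣≡1; ∣⊥∣≡0;
         p⊆q⇒∣p∣≤∣q∣; x∈⁅y⁆⇒x≡y; x∈⁅x⁆; ∣p∩q∣≤∣p∣; ∣p∩q∣≤∣q∣; ∩-identityʳ)
open import Data.Integer as ℤ using (ℤ)
import Data.Integer.Properties as ℤP
import Data.Integer.Tactic.RingSolver as ℤ-Solver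
open import Data.List as List using (List; []; _∷_)
open import Data.List.Membership.Propositional using (_∈_)
open import Data.List.Membership.Propositional.Properties
  using (∈-allFin; ∈-cartesianProduct⁺; ∈-lookup; ∈-map⁺; ∈-map⁻; ∈-filter⁺; ∈-filter⁻; ∈-concatMap⁺)
open import Data.List.Properties using (filter-accept; filter-reject)
open import Data.List.Relation.Unary.All as All using (All; []; _∷_)
open import Data.List.Relation.Unary.All.Properties using (all-filter)
open import Data.List.Relation.Unary.Any as Any using (here; there; index)
open import Data.List.Relation.Unary.Any.Properties using (lookup-index)
open import Data.Maybe using (Maybe; just; nothing)
open import Data.Nat as ℕ using (ℕ; zero; suc; _<ᵇ_)
open import Data.Nat.Induction using (<-wellFounded)
import Data.Nat.Properties as ℕP
open import Data.Product using (∃; _×_; _,_; proj₁; proj₂)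
open import Data.Rational
  using (ℚ; 0ℚ; 1ℚ; _+_; _*_; _-_; -_; _≤_; 1/_; toℚᵘ; NonZero; NonNegative; Positive; nonNegative; ≢-nonZero)
open import Data.Rational.Properties
import Data.Rational.Unnormalised as ℚᵘ
import Data.Rational.Unnormalised.Properties as ℚᵘP
open import Data.Sum using (_⊎_; inj₁; inj₂)
open import Data.Vec using ([]; _∷_; lookup; tabulate; _[_]≔_)
open import Data.Vec.Properties
  using (lookup-zipWith; lookup-replicate; lookup∘tabulate; tabulate∘lookup; tabulate-cong; lookup∘update;
         lookup∘update′; []≔-lookup; lookup⇒[]=; []=⇒lookup)
open import Induction.WellFounded using (Acc; acc)
open import Level using (0ℓ)
open import Relation.Binary using (tri<; tri≈; tri>)
open import Relation.Binary.PropositionalEquality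
open import Relation.Nullary
open import Relation.Nullary.Decidable using (_×-dec_; dec-true; dec-false)
open import Relation.Unary using (Decidable)
open import Tactic.RingSolver using (solve-∀)
import Tactic.RingSolver.Core.AlmostCommutativeRing as ACR

-- The hard inclusion is the one that splits a point of the base polytope of a sum into points of
-- the summands. The summands are never constructed from the point: a Minkowski sum of convex sets
-- is convex, so it suffices that it contains every greedy vertex of the summed function. For this
-- reason the decomposition theorem speaks of an arbitrary convex set, and neither facets nor linear
-- programming duality enter.
--
-- The slack element has two tasks. All points of a base polytope have the same total weight, while
-- those of I_M and D_J do not; the slack makes up the difference. It also encodes nonnegativity: F
-- takes its full value on every set containing 0, so x₀ + x(K) ≤ F(E ∪ {0}) = x₀ + x(E), that is,
-- x(E - K) ≥ 0.
--
-- A negative multiple of a submodular function is in general not submodular. The negative terms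
-- therefore stay on the side of I_M, each side is a nonnegative combination, and signs mix only in
-- an identity between set functions.

ℚ-ring : ACR.AlmostCommutativeRing 0ℓ 0ℓ
ℚ-ring = ACR.fromCommutativeRing +-*-commutativeRing isZero?
  where
  isZero? : ∀ p → Maybe (0ℚ ≡ p)
  isZero? p with 0ℚ ≟ p
  ... | yes e = just e
  ... | no _ = nothing

p+q-q≡p : ∀ p q → (p + q) - q ≡ p
p+q-q≡p = solve-∀ ℚ-ring

-- `toℚ` normalises its fraction, so the equation is checked on unnormalised representatives with
-- denominator 1.
toℚ-+ : ∀ a b → toℚ (a ℤ.+ b) ≡ toℚ a + toℚ b
toℚ-+ a b = toℚᵘ-injective (ℚᵘP.≃-trans (toℚᵘ-fromℚᵘ (ℚᵘ.mkℚᵘ (a ℤ.+ b) 0))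
  (ℚᵘP.≃-trans (ℚᵘ.*≡* (cong (ℤ._* (ℤ.+ 1)) (cong₂ ℤ._+_ (sym (ℤP.*-identityʳ a)) (sym (ℤP.*-identityʳ b)))))
  (ℚᵘP.≃-sym (ℚᵘP.≃-trans (toℚᵘ-homo-+ (toℚ a) (toℚ b))
    (ℚᵘP.+-cong (toℚᵘ-fromℚᵘ (ℚᵘ.mkℚᵘ a 0)) (toℚᵘ-fromℚᵘ (ℚᵘ.mkℚᵘ b 0)))))))

toℚ-neg : ∀ a → toℚ (ℤ.- a) ≡ - toℚ a
toℚ-neg a = begin
  toℚ (ℤ.- a)                        ≡⟨ p+q-q≡p (toℚ (ℤ.- a)) (toℚ a) ⟨
  (toℚ (ℤ.- a) + toℚ a) - toℚ a      ≡⟨ cong (_- toℚ a) (sym (toℚ-+ (ℤ.- a) a)) ⟩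
  toℚ (ℤ.- a ℤ.+ a) - toℚ a          ≡⟨ cong (λ z → toℚ z - toℚ a) (ℤP.+-inverseˡ a) ⟩
  0ℚ - toℚ a                         ≡⟨ +-identityˡ _ ⟩
  - toℚ a ∎
  where open ≡-Reasoning

toℚ-mono : ∀ {a b} → a ℤ.≤ b → toℚ a ≤ toℚ b
toℚ-mono {a} {b} a≤b = toℚᵘ-cancel-≤ (begin
  toℚᵘ (toℚ a) ≃⟨ toℚᵘ-fromℚᵘ (ℚᵘ.mkℚᵘ a 0) ⟩
  ℚᵘ.mkℚᵘ a 0  ≤⟨ ℚᵘ.*≤* (ℤP.*-monoʳ-≤-nonNeg (ℤ.+ 1) a≤b) ⟩
  ℚᵘ.mkℚᵘ b 0  ≃⟨ toℚᵘ-fromℚᵘ (ℚᵘ.mkℚᵘ b 0) ⟨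
  toℚᵘ (toℚ b) ∎)
  where open ℚᵘP.≤-Reasoning

0≤* : ∀ {p q} → 0ℚ ≤ p → 0ℚ ≤ q → 0ℚ ≤ p * q
0≤* {p} {q} 0≤p 0≤q = subst (_≤ p * q) (*-zeroʳ p)
  (*-monoˡ-≤-nonNeg p {{nonNegative 0≤p}} 0≤q)

0≤+ : ∀ {p q} → 0ℚ ≤ p → 0ℚ ≤ q → 0ℚ ≤ p + q
0≤+ = +-mono-≤

*-monoˡ : ∀ {p q c} → 0ℚ ≤ c → p ≤ q → c * p ≤ c * q
*-monoˡ {c = c} 0≤c = *-monoˡ-≤-nonNeg c {{nonNegative 0≤c}}

p≤q⇒0≤q-p : ∀ {p q} → p ≤ q → 0ℚ ≤ q - p
p≤q⇒0≤q-p {p} {q} p≤q = subst (_≤ q - p) (+-inverseʳ p) (+-monoˡ-≤ (- p) p≤q)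

+-interchange : ∀ a b c d → (a + b) + (c + d) ≡ (a + c) + (b + d)
+-interchange = solve-∀ ℚ-ring

sumFin-cong : ∀ {m} {f g : Fin m → ℚ} → (∀ i → f i ≡ g i) → sumFin m f ≡ sumFin m g
sumFin-cong {zero}  h = refl
sumFin-cong {suc m} h = cong₂ _+_ (h zero) (sumFin-cong (λ i → h (suc i)))

sumFin-+ : ∀ {m} (f g : Fin m → ℚ) → sumFin m (λ i → f i + g i) ≡ sumFin m f + sumFin m g
sumFin-+ {zero}  f g = refl
sumFin-+ {suc m} f g = trans (cong ((f zero + g zero) +_) (sumFin-+ (λ i → f (suc i)) (λ i → g (suc i))))
  (+-interchange (f zero) (g zero) _ _)

sumFin-* : ∀ {m} c (f : Fin m → ℚ) → sumFin m (λ i → c * f i) ≡ c * sumFin m f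
sumFin-* {zero}  c f = sym (*-zeroʳ c)
sumFin-* {suc m} c f = trans (cong ((c * f zero) +_) (sumFin-* c (λ i → f (suc i))))
  (sym (*-distribˡ-+ c _ _))

sumFin-0 : ∀ m → sumFin m (λ _ → 0ℚ) ≡ 0ℚ
sumFin-0 zero    = refl
sumFin-0 (suc m) = trans (+-identityˡ _) (sumFin-0 m)

sumFin-mono : ∀ {m} {f g : Fin m → ℚ} → (∀ i → f i ≤ g i) → sumFin m f ≤ sumFin m g
sumFin-mono {zero}  h = ≤-refl
sumFin-mono {suc m} h = +-mono-≤ (h zero) (sumFin-mono (λ i → h (suc i)))

sumFin-swap : ∀ {m l} (f : Fin m → Fin l → ℚ) →
  sumFin m (λ i → sumFin l (f i)) ≡ sumFin l (λ k → sumFin m (λ i → f i k))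
sumFin-swap {zero}  {l} f = sym (sumFin-0 l)
sumFin-swap {suc m} {l} f = trans (cong (sumFin l (f zero) +_) (sumFin-swap (λ i → f (suc i))))
  (sym (sumFin-+ (f zero) (λ k → sumFin m (λ i → f (suc i) k))))

sumFin-lin : ∀ {m} s t (f g : Fin m → ℚ) →
  sumFin m (λ i → s * f i + t * g i) ≡ s * sumFin m f + t * sumFin m g
sumFin-lin s t f g = trans (sumFin-+ (λ i → s * f i) (λ i → t * g i)) (cong₂ _+_ (sumFin-* s f) (sumFin-* t g))

basis-suc : ∀ {m} (i j : Fin m) → basis (suc i) (suc j) ≡ basis i j
basis-suc i j with i Fin.≟ j
... | yes _ = refl
... | no  _ = refl

sumFin-basis : ∀ {m} (f : Fin m → ℚ) i → sumFin m (λ j → f j * basis i j) ≡ f i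
sumFin-basis {suc m} f zero = begin
  f zero * 1ℚ + sumFin m (λ j → f (suc j) * 0ℚ)
    ≡⟨ cong₂ _+_ (*-identityʳ (f zero)) (trans (sumFin-cong (λ j → *-zeroʳ (f (suc j)))) (sumFin-0 m)) ⟩
  f zero + 0ℚ ≡⟨ +-identityʳ _ ⟩
  f zero ∎
  where open ≡-Reasoning
sumFin-basis {suc m} f (suc i) = begin
  f zero * 0ℚ + sumFin m (λ j → f (suc j) * basis (suc i) (suc j))
    ≡⟨ cong₂ _+_ (*-zeroʳ (f zero)) (trans (sumFin-cong (λ j → cong (f (suc j) *_) (basis-suc i j)))
         (sumFin-basis (λ j → f (suc j)) i)) ⟩
  0ℚ + f (suc i) ≡⟨ +-identityˡ _ ⟩
  f (suc i) ∎
  where open ≡-Reasoning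

-- Weight of a point on a set

weight : ∀ {m} → Point m → Subset m → ℚ
weight {m} x K = sumFin m (λ i → indicator K i * x i)

weight-lin : ∀ {m} s t (x y : Point m) K →
  weight (λ i → s * x i + t * y i) K ≡ s * weight x K + t * weight y K
weight-lin s t x y K = trans (sumFin-cong (λ i → shuffle s t (indicator K i) (x i) (y i)))
  (sumFin-lin s t (λ i → indicator K i * x i) (λ i → indicator K i * y i))
  where
  shuffle : ∀ s t k x y → k * (s * x + t * y) ≡ s * (k * x) + t * (k * y)
  shuffle = solve-∀ ℚ-ring

weight-+ : ∀ {m} (x y : Point m) K → weight (λ i → x i + y i) K ≡ weight x K + weight y K
weight-+ x y K = trans (sumFin-cong (λ i → *-distribˡ-+ (indicator K i) (x i) (y i)))
  (sumFin-+ (λ i → indicator K i * x i) (λ i → indicator K i * y i))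

weight-* : ∀ {m} c (x : Point m) K → weight (λ i → c * x i) K ≡ c * weight x K
weight-* c x K = trans (sumFin-cong (λ i → shuffle c (indicator K i) (x i))) (sumFin-* c (λ i → indicator K i * x i))
  where
  shuffle : ∀ c k x → k * (c * x) ≡ c * (k * x)
  shuffle = solve-∀ ℚ-ring

weight-cong : ∀ {m} {x y : Point m} K → x ≈ᵖ y → weight x K ≡ weight y K
weight-cong K x≈y = sumFin-cong (λ i → cong (indicator K i *_) (x≈y i))

weight-basis : ∀ {m} (i : Fin m) K → weight (basis i) K ≡ indicator K i
weight-basis i K = sumFin-basis (indicator K) i

weight-0 : ∀ {m} (K : Subset m) → weight zeroPt K ≡ 0ℚ
weight-0 {m} K = trans (sumFin-cong (λ i → *-zeroʳ (indicator K i))) (sumFin-0 m)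

bit : Bool → ℚ
bit b = if b then 1ℚ else 0ℚ

bit-modular : ∀ a b → bit (a ∨ b) + bit (a ∧ b) ≡ bit a + bit b
bit-modular true  true  = refl
bit-modular true  false = refl
bit-modular false true  = refl
bit-modular false false = refl

weight-modular : ∀ {m} (x : Point m) K L → weight x (K ∪ L) + weight x (K ∩ L) ≡ weight x K + weight x L
weight-modular {m} x K L = begin
  weight x (K ∪ L) + weight x (K ∩ L) ≡⟨ sumFin-+ (λ i → indicator (K ∪ L) i * x i) (λ i → indicator (K ∩ L) i * x i) ⟨
  sumFin m (λ i → indicator (K ∪ L) i * x i + indicator (K ∩ L) i * x i)
    ≡⟨ sumFin-cong (λ i → begin
         indicator (K ∪ L) i * x i + indicator (K ∩ L) i * x i
           ≡⟨ *-distribʳ-+ (x i) (indicator (K ∪ L) i) (indicator (K ∩ L) i) ⟨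
         (indicator (K ∪ L) i + indicator (K ∩ L) i) * x i
           ≡⟨ cong (_* x i) (trans (cong₂ (λ a b → bit a + bit b) (lookup-zipWith _∨_ i K L) (lookup-zipWith _∧_ i K L))
                (bit-modular (lookup K i) (lookup L i))) ⟩
         (indicator K i + indicator L i) * x i
           ≡⟨ *-distribʳ-+ (x i) (indicator K i) (indicator L i) ⟩
         indicator K i * x i + indicator L i * x i ∎) ⟩
  sumFin m (λ i → indicator K i * x i + indicator L i * x i) ≡⟨ sumFin-+ (λ i → indicator K i * x i) (λ i → indicator L i * x i) ⟩
  weight x K + weight x L ∎
  where open ≡-Reasoning

weight-⊥ : ∀ {m} (x : Point m) → weight x ⊥ ≡ 0ℚ
weight-⊥ {m} x = trans (sumFin-cong (λ i → trans (cong (λ b → bit b * x i) (lookup-replicate i outside))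
  (*-zeroˡ (x i)))) (sumFin-0 m)

-- Base polytopes and their greedy vertices

subset-ext : ∀ {m} {X Y : Subset m} → (∀ i → lookup X i ≡ lookup Y i) → X ≡ Y
subset-ext {X = X} {Y} h = trans (sym (tabulate∘lookup X)) (trans (tabulate-cong h) (tabulate∘lookup Y))

SetFunction : ℕ → Set
SetFunction m = Subset m → ℚ

Submodular : ∀ {m} → SetFunction m → Set
Submodular F = ∀ X Y → F (X ∪ Y) + F (X ∩ Y) ≤ F X + F Y

BasePolytope : ∀ {m} → SetFunction m → PSet m
BasePolytope F x = (∀ K → weight x K ≤ F K) × weight x ⊤ ≡ F ⊤

Tight : ∀ {m} → SetFunction m → Point m → Subset m → Set
Tight F x K = weight x K ≡ F K

Convex : ∀ {m} → PSet m → Set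
Convex P = ∀ {p q} s t → 0ℚ ≤ s → 0ℚ ≤ t → s + t ≡ 1ℚ → P p → P q → P (λ i → s * p i + t * q i)

-- Points are functions compared pointwise, and an arbitrary predicate on them need not respect
-- `≈ᵖ`.
Extensional : ∀ {m} → PSet m → Set
Extensional P = ∀ {p q} → p ≈ᵖ q → P p → P q

private
  squeeze : ∀ {u v U V} → u ≤ U → v ≤ V → U + V ≤ u + v → u ≡ U
  squeeze {u} {v} {U} {V} u≤U v≤V h = ≤-antisym u≤U (begin
    U           ≡⟨ p+q-q≡p U V ⟨
    (U + V) - V ≤⟨ +-monoˡ-≤ (- V) h ⟩
    (u + v) - V ≤⟨ +-monoʳ-≤ (u + v) (neg-antimono-≤ v≤V) ⟩
    (u + v) - v ≡⟨ p+q-q≡p u v ⟩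
    u           ∎)
    where open ≤-Reasoning

-- Uncrossing: weight is modular and `F` submodular, so the slacks of `X ∪ Y` and `X ∩ Y` have sum
-- at most 0. Both are nonnegative, hence both vanish.
tight-∪∩ : ∀ {m} {F : SetFunction m} {x} → Submodular F → (∀ K → weight x K ≤ F K) →
  ∀ {X Y} → Tight F x X → Tight F x Y → Tight F x (X ∪ Y) × Tight F x (X ∩ Y)
tight-∪∩ {F = F} {x} sub x≤F {X} {Y} tX tY =
  squeeze (x≤F (X ∪ Y)) (x≤F (X ∩ Y)) h ,
  squeeze (x≤F (X ∩ Y)) (x≤F (X ∪ Y)) (subst₂ _≤_ (+-comm (F (X ∪ Y)) (F (X ∩ Y)))
    (+-comm (weight x (X ∪ Y)) (weight x (X ∩ Y))) h)
  where
  h : F (X ∪ Y) + F (X ∩ Y) ≤ weight x (X ∪ Y) + weight x (X ∩ Y)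
  h = subst (F (X ∪ Y) + F (X ∩ Y) ≤_)
    (trans (sym (cong₂ _+_ tX tY)) (sym (weight-modular x X Y))) (sub X Y)

-- Moving a point until a new set becomes tight

argmin : ∀ {m} (φ : Subset m → ℚ) → ∃ λ K → ∀ L → φ K ≤ φ L
argmin {zero}  φ = [] , λ { [] → ≤-refl }
argmin {suc m} φ with argmin (λ K → φ (outside ∷ K)) | argmin (λ K → φ (inside ∷ K))
... | K₀ , min₀ | K₁ , min₁ with ≤-total (φ (outside ∷ K₀)) (φ (inside ∷ K₁))
... | inj₁ le = outside ∷ K₀ , λ { (outside ∷ L) → min₀ L ; (inside ∷ L) → ≤-trans le (min₁ L) }
... | inj₂ ge = inside ∷ K₁ , λ { (outside ∷ L) → ≤-trans ge (min₀ L) ; (inside ∷ L) → min₁ L }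

shift : ∀ {m} → Fin m → Fin m → ℚ → Point m → Point m
shift i j a x e = x e + a * (basis i e - basis j e)

weight-shift : ∀ {m} (i j : Fin m) a x K →
  weight (shift i j a x) K ≡ weight x K + a * (indicator K i - indicator K j)
weight-shift i j a x K = begin
  weight (shift i j a x) K
    ≡⟨ weight-+ x (λ e → a * (basis i e - basis j e)) K ⟩
  weight x K + weight (λ e → a * (basis i e - basis j e)) K
    ≡⟨ cong (weight x K +_) (trans (weight-cong K (λ e → expand a (basis i e) (basis j e)))
         (weight-lin a (- a) (basis i) (basis j) K)) ⟩
  weight x K + (a * weight (basis i) K + (- a) * weight (basis j) K)
    ≡⟨ cong₂ (λ p q → weight x K + (a * p + (- a) * q)) (weight-basis i K) (weight-basis j K) ⟩
  weight x K + (a * indicator K i + (- a) * indicator K j)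
    ≡⟨ cong (weight x K +_) (expand a (indicator K i) (indicator K j)) ⟨
  weight x K + a * (indicator K i - indicator K j) ∎
  where
  open ≡-Reasoning
  expand : ∀ a p q → a * (p - q) ≡ a * p + (- a) * q
  expand = solve-∀ ℚ-ring

-- Moving along e_i - e_j raises, at unit rate, exactly the weights of the sets that contain `i` but
-- not `j`. The least slack among these sets is thus the longest admissible step, and the set
-- attaining it becomes tight.
push : ∀ {m} {F : SetFunction m} {x} {i j : Fin m} → BasePolytope F x → i ≢ j →
  ∃ λ a → ∃ λ K → 0ℚ ≤ a × lookup K i ≡ inside × lookup K j ≡ outside ×
    BasePolytope F (shift i j a x) × Tight F (shift i j a x) K
push {m} {F} {x} {i} {j} (x≤F , x⊤) i≢j =
  a , K , p≤q⇒0≤q-p (x≤F K) , Ki , Kj , (≤F , ⊤-tight) , K-tight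
  where
  -- `argmin` ranges over all subsets, so each is first forced to contain `i` and omit `j`. Sets
  -- already of that kind are unchanged, hence none of them escapes the minimum.
  separate : Subset m → Subset m
  separate K = (K [ i ]≔ inside) [ j ]≔ outside

  separate-i : ∀ K → lookup (separate K) i ≡ inside
  separate-i K = trans (lookup∘update′ i≢j (K [ i ]≔ inside) outside) (lookup∘update i K inside)

  separate-j : ∀ K → lookup (separate K) j ≡ outside
  separate-j K = lookup∘update j (K [ i ]≔ inside) outside

  separate-id : ∀ K → lookup K i ≡ inside → lookup K j ≡ outside → separate K ≡ K
  separate-id K ki kj = trans (cong (λ X → X [ j ]≔ outside)
      (trans (cong (K [ i ]≔_) (sym ki)) ([]≔-lookup K i)))
    (trans (cong (K [ j ]≔_) (sym kj)) ([]≔-lookup K j))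

  slack : Subset m → ℚ
  slack K = F K - weight x K

  K : Subset m
  K = separate (proj₁ (argmin (λ X → slack (separate X))))

  a : ℚ
  a = slack K

  Ki : lookup K i ≡ inside
  Ki = separate-i (proj₁ (argmin (λ X → slack (separate X))))

  Kj : lookup K j ≡ outside
  Kj = separate-j (proj₁ (argmin (λ X → slack (separate X))))

  a-min : ∀ L → lookup L i ≡ inside → lookup L j ≡ outside → a ≤ slack L
  a-min L li lj = subst (λ X → a ≤ slack X) (separate-id L li lj)
    (proj₂ (argmin (λ X → slack (separate X))) L)

  0≤a : 0ℚ ≤ a
  0≤a = p≤q⇒0≤q-p (x≤F K)

  weight-y : ∀ L {b c} d → lookup L i ≡ b → lookup L j ≡ c → bit b - bit c ≡ d →
    weight (shift i j a x) L ≡ weight x L + a * d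
  weight-y L d refl refl eq = trans (weight-shift i j a x L) (cong (λ d → weight x L + a * d) eq)

  times-0 : ∀ w a → w + a * 0ℚ ≡ w
  times-0 = solve-∀ ℚ-ring
  times-1 : ∀ w f → w + (f - w) * 1ℚ ≡ f
  times-1 = solve-∀ ℚ-ring

  equal : ∀ L → (b : Bool) → lookup L i ≡ b → lookup L j ≡ b → weight (shift i j a x) L ≡ weight x L
  equal L false li lj = trans (weight-y L 0ℚ li lj refl) (times-0 (weight x L) a)
  equal L true  li lj = trans (weight-y L 0ℚ li lj refl) (times-0 (weight x L) a)

  ≤F : ∀ L → weight (shift i j a x) L ≤ F L
  ≤F L with lookup L i in li | lookup L j in lj
  ... | false | false = subst (_≤ F L) (sym (equal L false li lj)) (x≤F L)
  ... | true  | true  = subst (_≤ F L) (sym (equal L true li lj)) (x≤F L)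
  ... | true  | false = begin
    weight (shift i j a x) L             ≡⟨ weight-y L 1ℚ li lj refl ⟩
    weight x L + a * 1ℚ                  ≡⟨ cong (weight x L +_) (*-identityʳ a) ⟩
    weight x L + a                       ≤⟨ +-monoʳ-≤ (weight x L) (a-min L li lj) ⟩
    weight x L + (F L - weight x L)      ≡⟨ cancel (weight x L) (F L) ⟩
    F L                                  ∎
    where
    open ≤-Reasoning
    cancel : ∀ w f → w + (f - w) ≡ f
    cancel = solve-∀ ℚ-ring
  ... | false | true = begin
    weight (shift i j a x) L             ≡⟨ weight-y L (- 1ℚ) li lj refl ⟩
    weight x L + a * (- 1ℚ)              ≡⟨ negate (weight x L) a ⟩
    weight x L + (- a)                   ≤⟨ +-monoʳ-≤ (weight x L) (neg-antimono-≤ 0≤a) ⟩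
    weight x L + 0ℚ                      ≡⟨ +-identityʳ (weight x L) ⟩
    weight x L                           ≤⟨ x≤F L ⟩
    F L                                  ∎
    where
    open ≤-Reasoning
    negate : ∀ w a → w + a * (- 1ℚ) ≡ w + (- a)
    negate = solve-∀ ℚ-ring

  ⊤-tight : Tight F (shift i j a x) ⊤
  ⊤-tight = trans (equal ⊤ true (lookup-replicate i inside) (lookup-replicate j inside)) x⊤

  K-tight : Tight F (shift i j a x) K
  K-tight = trans (weight-y K 1ℚ Ki Kj refl) (times-1 (weight x K) (F K))

-- The displacements a(e_i - e_j) and b(e_j - e_i) cancel under the weights b/(a+b) and a/(a+b). For
-- a = 0 the first endpoint is already `x`; otherwise a + b is positive and can be inverted.
segment : ∀ {m} {P : PSet m} → Convex P → Extensional P → ∀ {i j a b x} → 0ℚ ≤ a → 0ℚ ≤ b →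
  P (shift i j a x) → P (shift j i b x) → P x
segment {P = P} cvx ext {i} {j} {a} {b} {x} 0≤a 0≤b Py Pz with a ≟ 0ℚ
... | yes refl = ext (λ e → collapse (x e) (basis i e - basis j e)) Py
  where
  collapse : ∀ x d → x + 0ℚ * d ≡ x
  collapse = solve-∀ ℚ-ring
... | no a≢0 = ext mix (cvx (b * c) (a * c) (0≤* 0≤b 0≤c) (0≤* 0≤a 0≤c) sum≡1 Py Pz)
  where
  instance
    a≥0 : NonNegative a
    a≥0 = nonNegative 0≤a
    b≥0 : NonNegative b
    b≥0 = nonNegative 0≤b
    a>0 : Positive a
    a>0 = nonNeg∧nonZero⇒pos a {{a≥0}} {{≢-nonZero a≢0}}
    a+b>0 : Positive (a + b)
    a+b>0 = pos+nonNeg⇒pos a b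
    a+b≢0 : NonZero (a + b)
    a+b≢0 = pos⇒nonZero (a + b)

  c : ℚ
  c = 1/ (a + b)

  0≤c : 0ℚ ≤ c
  0≤c = nonNegative⁻¹ c {{pos⇒nonNeg c {{1/pos⇒pos (a + b)}}}}

  regroup : ∀ a b c → b * c + a * c ≡ (a + b) * c
  regroup = solve-∀ ℚ-ring

  sum≡1 : b * c + a * c ≡ 1ℚ
  sum≡1 = trans (regroup a b c) (*-inverseʳ (a + b))

  cancel : ∀ a b c x u v →
    (b * c) * (x + a * (u - v)) + (a * c) * (x + b * (v - u)) ≡ (b * c + a * c) * x
  cancel = solve-∀ ℚ-ring

  mix : ∀ e → (b * c) * shift i j a x e + (a * c) * shift j i b x e ≡ x e
  mix e = trans (cancel a b c (x e) (basis i e) (basis j e))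
    (trans (cong (_* x e) sum≡1) (*-identityˡ (x e)))

-- A chain of sets is encoded by a labelling of the elements: its members are the sets of elements
-- with label below `s`. Refining a chain is then arithmetic on labels, and labels may leave gaps.
level : ∀ {m} → (Fin m → ℕ) → ℕ → Subset m
level ℓ s = tabulate (λ e → ℓ e <ᵇ s)

lookup-level : ∀ {m} (ℓ : Fin m → ℕ) s e → lookup (level ℓ s) e ≡ (ℓ e <ᵇ s)
lookup-level ℓ s e = lookup∘tabulate (λ e → ℓ e <ᵇ s) e

level-zero : ∀ {m} (ℓ : Fin m → ℕ) → level ℓ 0 ≡ ⊥
level-zero ℓ = subset-ext (λ e → trans (lookup-level ℓ 0 e) (sym (lookup-replicate e outside)))

<⇒<ᵇ≡true : ∀ {a b} → a ℕ.< b → (a <ᵇ b) ≡ true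
<⇒<ᵇ≡true {a} {b} = dec-true (a ℕP.<? b)

≮⇒<ᵇ≡false : ∀ {a b} → ¬ (a ℕ.< b) → (a <ᵇ b) ≡ false
≮⇒<ᵇ≡false {a} {b} = dec-false (a ℕP.<? b)

<ᵇ-suc-≢ : ∀ {a b} → a ≢ b → (a <ᵇ suc b) ≡ (a <ᵇ b)
<ᵇ-suc-≢ {a} {b} a≢b with a ℕP.<? b
... | yes a<b = trans (<⇒<ᵇ≡true (ℕP.m<n⇒m<1+n a<b)) (sym (<⇒<ᵇ≡true a<b))
... | no a≮b = trans (≮⇒<ᵇ≡false (λ a<1+b → a≮b (ℕP.≤∧≢⇒< (ℕ.s≤s⁻¹ a<1+b) a≢b))) (sym (≮⇒<ᵇ≡false a≮b))

Injectiveℕ : ∀ {m} → (Fin m → ℕ) → Set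
Injectiveℕ ℓ = ∀ {i j} → ℓ i ≡ ℓ j → i ≡ j

-- The greedy vertex for the order given by `ℓ`: each coordinate is the marginal gain of its element
-- over the elements with smaller labels. For fixed `ℓ` it is linear in `F`.
vertex : ∀ {m} → (Fin m → ℕ) → SetFunction m → Point m
vertex ℓ F i = F (level ℓ (suc (ℓ i))) - F (level ℓ (ℓ i))

indicator-level-suc : ∀ {m} {ℓ : Fin m → ℕ} → Injectiveℕ ℓ → ∀ i e →
  indicator (level ℓ (suc (ℓ i))) e ≡ indicator (level ℓ (ℓ i)) e + basis i e
indicator-level-suc {ℓ = ℓ} inj i e
  rewrite lookup-level ℓ (suc (ℓ i)) e | lookup-level ℓ (ℓ i) e with i Fin.≟ e
... | yes refl rewrite <⇒<ᵇ≡true (ℕP.n<1+n (ℓ i)) | ≮⇒<ᵇ≡false (ℕP.n≮n (ℓ i)) = refl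
... | no i≢e rewrite <ᵇ-suc-≢ (λ eq → i≢e (sym (inj eq))) = sym (+-identityʳ (bit (ℓ e <ᵇ ℓ i)))

weight-level-suc : ∀ {m} {ℓ : Fin m → ℕ} → Injectiveℕ ℓ → ∀ (x : Point m) i →
  weight x (level ℓ (suc (ℓ i))) ≡ weight x (level ℓ (ℓ i)) + x i
weight-level-suc {m} {ℓ} inj x i = begin
  weight x (level ℓ (suc (ℓ i)))
    ≡⟨ sumFin-cong (λ e → trans (cong (_* x e) (indicator-level-suc inj i e))
         (expand (indicator (level ℓ (ℓ i)) e) (basis i e) (x e))) ⟩
  sumFin m (λ e → indicator (level ℓ (ℓ i)) e * x e + x e * basis i e)
    ≡⟨ sumFin-+ (λ e → indicator (level ℓ (ℓ i)) e * x e) (λ e → x e * basis i e) ⟩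
  weight x (level ℓ (ℓ i)) + sumFin m (λ e → x e * basis i e)
    ≡⟨ cong (weight x (level ℓ (ℓ i)) +_) (sumFin-basis x i) ⟩
  weight x (level ℓ (ℓ i)) + x i ∎
  where
  open ≡-Reasoning
  expand : ∀ k b x → (k + b) * x ≡ k * x + x * b
  expand = solve-∀ ℚ-ring

-- By injectivity the levels just below and just above label `ℓ i` differ in `i` alone, so tightness
-- of these two determines the coordinate `x i`.
tight⇒vertex : ∀ {m} {F : SetFunction m} {x ℓ} → Injectiveℕ ℓ →
  (∀ s → Tight F x (level ℓ s)) → vertex ℓ F ≈ᵖ x
tight⇒vertex {F = F} {x} {ℓ} inj tight i = begin
  F (level ℓ (suc (ℓ i))) - F (level ℓ (ℓ i))
    ≡⟨ cong₂ _-_ (tight (suc (ℓ i))) (tight (ℓ i)) ⟨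
  weight x (level ℓ (suc (ℓ i))) - weight x (level ℓ (ℓ i))
    ≡⟨ cong (_- weight x (level ℓ (ℓ i))) (weight-level-suc inj x i) ⟩
  (weight x (level ℓ (ℓ i)) + x i) - weight x (level ℓ (ℓ i))
    ≡⟨ cancel (weight x (level ℓ (ℓ i))) (x i) ⟩
  x i ∎
  where
  open ≡-Reasoning
  cancel : ∀ w x → (w + x) - w ≡ x
  cancel = solve-∀ ℚ-ring

-- Refining a chain by one more set

double : ℕ → ℕ
double zero    = zero
double (suc k) = suc (suc (double k))

even∨odd : ∀ s → ∃ λ t → s ≡ double t ⊎ s ≡ suc (double t)
even∨odd zero = zero , inj₁ refl
even∨odd (suc s) with even∨odd s
... | t , inj₁ refl = t , inj₂ refl
... | t , inj₂ refl = suc t , inj₁ refl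

double-<ᵇ-double : ∀ a b → (double a <ᵇ double b) ≡ (a <ᵇ b)
double-<ᵇ-double a       zero    = refl
double-<ᵇ-double zero    (suc b) = refl
double-<ᵇ-double (suc a) (suc b) = double-<ᵇ-double a b

suc-double-<ᵇ-double : ∀ a b → (suc (double a) <ᵇ double b) ≡ (a <ᵇ b)
suc-double-<ᵇ-double a       zero    = refl
suc-double-<ᵇ-double zero    (suc b) = refl
suc-double-<ᵇ-double (suc a) (suc b) = suc-double-<ᵇ-double a b

double-<ᵇ-suc-double : ∀ a b → (double a <ᵇ suc (double b)) ≡ (a <ᵇ suc b)
double-<ᵇ-suc-double zero    b       = refl
double-<ᵇ-suc-double (suc a) zero    = refl
double-<ᵇ-suc-double (suc a) (suc b) = double-<ᵇ-suc-double a b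

<ᵇ-∨-suc : ∀ a b → (a <ᵇ b) ∨ (a <ᵇ suc b) ≡ (a <ᵇ suc b)
<ᵇ-∨-suc a       zero    = refl
<ᵇ-∨-suc zero    (suc b) = refl
<ᵇ-∨-suc (suc a) (suc b) = <ᵇ-∨-suc a b

double-injective : ∀ {a b} → double a ≡ double b → a ≡ b
double-injective {zero}  {zero}  _  = refl
double-injective {suc a} {suc b} eq = cong suc (double-injective (ℕP.suc-injective (ℕP.suc-injective eq)))

double≢suc-double : ∀ {a b} → double a ≢ suc (double b)
double≢suc-double {suc a} {suc b} eq = double≢suc-double (ℕP.suc-injective (ℕP.suc-injective eq))

-- Each layer of the chain is cut in two, members of the new set first. Doubling makes room for this
-- while keeping the order between layers.
splitLevel : Bool → ℕ → ℕ
splitLevel inside  k = double k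
splitLevel outside k = suc (double k)

refine : ∀ {m} → (Fin m → ℕ) → Subset m → Fin m → ℕ
refine ℓ K e = splitLevel (lookup K e) (ℓ e)

splitLevel-injective : ∀ b c {j k} → splitLevel b j ≡ splitLevel c k → b ≡ c × j ≡ k
splitLevel-injective true  true  eq = refl , double-injective eq
splitLevel-injective false false eq = refl , double-injective (ℕP.suc-injective eq)
splitLevel-injective true  false eq = contradiction eq double≢suc-double
splitLevel-injective false true  eq = contradiction (sym eq) double≢suc-double

level-refine-even : ∀ {m} (ℓ : Fin m → ℕ) K t → level (refine ℓ K) (double t) ≡ level ℓ t
level-refine-even ℓ K t = tabulate-cong (λ e → lemma (lookup K e) (ℓ e))
  where
  lemma : ∀ b k → (splitLevel b k <ᵇ double t) ≡ (k <ᵇ t)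
  lemma true  k = double-<ᵇ-double k t
  lemma false k = suc-double-<ᵇ-double k t

level-refine-odd : ∀ {m} (ℓ : Fin m → ℕ) K t →
  level (refine ℓ K) (suc (double t)) ≡ level ℓ t ∪ (level ℓ (suc t) ∩ K)
level-refine-odd ℓ K t = subset-ext λ e → begin
  lookup (level (refine ℓ K) (suc (double t))) e
    ≡⟨ lookup-level (refine ℓ K) (suc (double t)) e ⟩
  (splitLevel (lookup K e) (ℓ e) <ᵇ suc (double t))
    ≡⟨ lemma (lookup K e) (ℓ e) ⟩
  (ℓ e <ᵇ t) ∨ ((ℓ e <ᵇ suc t) ∧ lookup K e)
    ≡⟨ cong₂ (λ b c → b ∨ (c ∧ lookup K e)) (lookup-level ℓ t e) (lookup-level ℓ (suc t) e) ⟨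
  lookup (level ℓ t) e ∨ (lookup (level ℓ (suc t)) e ∧ lookup K e)
    ≡⟨ cong (lookup (level ℓ t) e ∨_) (lookup-zipWith _∧_ e (level ℓ (suc t)) K) ⟨
  lookup (level ℓ t) e ∨ lookup (level ℓ (suc t) ∩ K) e
    ≡⟨ lookup-zipWith _∨_ e (level ℓ t) (level ℓ (suc t) ∩ K) ⟨
  lookup (level ℓ t ∪ (level ℓ (suc t) ∩ K)) e ∎
  where
  open ≡-Reasoning
  lemma : ∀ b k → (splitLevel b k <ᵇ suc (double t)) ≡ (k <ᵇ t) ∨ ((k <ᵇ suc t) ∧ b)
  lemma true  k = trans (double-<ᵇ-suc-double k t)
    (sym (trans (cong ((k <ᵇ t) ∨_) (∧-identityʳ _)) (<ᵇ-∨-suc k t)))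
  lemma false k = trans (double-<ᵇ-double k t)
    (sym (trans (cong ((k <ᵇ t) ∨_) (∧-zeroʳ _)) (∨-identityʳ _)))

-- Even levels of the refined chain are old levels. An odd one arises from two consecutive old
-- levels and `K` by one intersection and one union, so uncrossing twice keeps it tight.
refine-tight : ∀ {m} {F : SetFunction m} {x} → Submodular F → (∀ K → weight x K ≤ F K) →
  ∀ {ℓ K} → (∀ s → Tight F x (level ℓ s)) → Tight F x K → ∀ s → Tight F x (level (refine ℓ K) s)
refine-tight {F = F} {x} sub x≤F {ℓ} {K} tight tightK s with even∨odd s
... | t , inj₁ refl = subst (Tight F x) (sym (level-refine-even ℓ K t)) (tight t)
... | t , inj₂ refl = subst (Tight F x) (sym (level-refine-odd ℓ K t))
  (proj₁ (tight-∪∩ {F = F} {x} sub x≤F (tight t)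
    (proj₂ (tight-∪∩ {F = F} {x} sub x≤F (tight (suc t)) tightK))))

module _ {m} {F : SetFunction m} (sub : Submodular F) {P : PSet m}
  (cvx : Convex P) (ext : Extensional P) (vertices : ∀ {ℓ} → Injectiveℕ ℓ → P (vertex ℓ F)) where

  private
    -- Elements with equal labels belong to the same levels, so moving mass from one to the other
    -- changes no level's weight.
    shift-tight : ∀ {x ℓ i j} a → ℓ i ≡ ℓ j → (∀ s → Tight F x (level ℓ s)) →
      ∀ s → Tight F (shift i j a x) (level ℓ s)
    shift-tight {x} {ℓ} {i} {j} a ℓi≡ℓj tight s = begin
      weight (shift i j a x) L                          ≡⟨ weight-shift i j a x L ⟩
      weight x L + a * (indicator L i - indicator L j)  ≡⟨ cong (λ k → weight x L + a * (k - indicator L j)) same ⟩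
      weight x L + a * (indicator L j - indicator L j)  ≡⟨ cancel (weight x L) a (indicator L j) ⟩
      weight x L                                        ≡⟨ tight s ⟩
      F L ∎
      where
      open ≡-Reasoning
      L = level ℓ s
      same : indicator L i ≡ indicator L j
      same = cong bit (trans (lookup-level ℓ s i) (trans (cong (_<ᵇ s) ℓi≡ℓj) (sym (lookup-level ℓ s j))))
      cancel : ∀ w a k → w + a * (k - k) ≡ w
      cancel = solve-∀ ℚ-ring

  -- The pairs not yet separated by the chain of tight sets level ℓ 0 ⊆ level ℓ 1 ⊆ … are all listed.
  decompose : (pairs : List (Fin m × Fin m)) → ∀ {x ℓ} → BasePolytope F x →
    (∀ s → Tight F x (level ℓ s)) → (∀ {e e′} → ℓ e ≡ ℓ e′ → e ≡ e′ ⊎ (e , e′) ∈ pairs) → P x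
  decompose [] {x} {ℓ} x∈B tight sep = ext (tight⇒vertex {F = F} {x} {ℓ} inj tight) (vertices inj)
    where
    inj : Injectiveℕ _
    inj eq with sep eq
    ... | inj₁ e≡e′ = e≡e′
  decompose ((i , j) ∷ pairs) {x} {ℓ} x∈B tight sep = split (i Fin.≟ j) (ℓ i ℕ.≟ ℓ j)
    where
    skip : (ℓ i ≡ ℓ j → i ≡ j) → P x
    skip h = decompose pairs {x} {ℓ} x∈B tight sep′
      where
      sep′ : ∀ {e e′} → ℓ e ≡ ℓ e′ → e ≡ e′ ⊎ (e , e′) ∈ pairs
      sep′ eq with sep eq
      ... | inj₁ e≡e′           = inj₁ e≡e′
      ... | inj₂ (here refl)    = inj₁ (h eq)
      ... | inj₂ (there ∈pairs) = inj₂ ∈pairs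

    separated : ∀ K → lookup K i ≢ lookup K j →
      ∀ {e e′} → refine ℓ K e ≡ refine ℓ K e′ → e ≡ e′ ⊎ (e , e′) ∈ pairs
    separated K Ki≢Kj {e} {e′} eq with splitLevel-injective (lookup K e) (lookup K e′) eq
    ... | Ke≡Ke′ , ℓe≡ℓe′ with sep ℓe≡ℓe′
    ... | inj₁ e≡e′           = inj₁ e≡e′
    ... | inj₂ (here refl)    = contradiction Ke≡Ke′ Ki≢Kj
    ... | inj₂ (there ∈pairs) = inj₂ ∈pairs

    true≢false : ∀ {c d : Bool} → c ≡ true → d ≡ false → c ≢ d
    true≢false refl refl ()

    pushed : ∀ {k l} → ℓ k ≡ ℓ l → ∀ {a K} → (lookup K i ≢ lookup K j) →
      BasePolytope F (shift k l a x) → Tight F (shift k l a x) K → P (shift k l a x)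
    pushed {k} {l} ℓk≡ℓl {a} {K} Ki≢Kj y∈B yK = decompose pairs {shift k l a x} {refine ℓ K} y∈B
      (refine-tight {x = shift k l a x} sub (proj₁ y∈B) {ℓ} {K} (shift-tight {x} {ℓ} a ℓk≡ℓl tight) yK)
      (separated K Ki≢Kj)

    split : Dec (i ≡ j) → Dec (ℓ i ≡ ℓ j) → P x
    split (yes i≡j) _          = skip (λ _ → i≡j)
    split (no _)   (no ℓi≢ℓj)  = skip (λ ℓi≡ℓj → contradiction ℓi≡ℓj ℓi≢ℓj)
    split (no i≢j) (yes ℓi≡ℓj) =
      let a , K , 0≤a , Ki , Kj , y∈B , yK = push {F = F} {x} {i} {j} x∈B i≢j
          b , L , 0≤b , Lj , Li , z∈B , zL = push {F = F} {x} {j} {i} x∈B (≢-sym i≢j)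
      in segment {P = P} cvx ext {i} {j} {a} {b} {x} 0≤a 0≤b
           (pushed {i} {j} ℓi≡ℓj {a} {K} (true≢false Ki Kj) y∈B yK)
           (pushed {j} {i} (sym ℓi≡ℓj) {b} {L} (≢-sym (true≢false Lj Li)) z∈B zL)

  -- The constant labelling 0 has only the levels `⊥` and `⊤`. The first is tight by normalisation,
  -- the second by the equation defining the base polytope; no pair is separated yet, so all are
  -- listed.
  basePolytope⊆ : F ⊥ ≡ 0ℚ → ∀ {x} → BasePolytope F x → P x
  basePolytope⊆ F⊥ {x} x∈B@(_ , x⊤) =
    decompose (List.cartesianProduct (List.allFin m) (List.allFin m)) {x} {λ _ → 0} x∈B tight
      (λ {e} {e′} _ → inj₂ (∈-cartesianProduct⁺ (∈-allFin e) (∈-allFin e′)))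
    where
    tight : ∀ s → Tight F x (level (λ _ → 0) s)
    tight zero    = subst (Tight F x) (sym (level-zero (λ _ → 0))) (trans (weight-⊥ x) (sym F⊥))
    tight (suc s) = subst (Tight F x) (sym (subset-ext (λ e →
      trans (lookup-level (λ _ → 0) (suc s) e) (sym (lookup-replicate e inside))))) x⊤

-- Projections of base polytopes

infixr 5 _◂_
_◂_ : ∀ {n} → ℚ → Point n → Point (suc n)
(x₀ ◂ x) zero    = x₀
(x₀ ◂ x) (suc i) = x i

Polymatroid : ∀ {n} → SetFunction (suc n) → PSet n
Polymatroid F x = ∃ λ x₀ → BasePolytope F (x₀ ◂ x)

-- The extra element zero of the ground set carries the slack F ⊤ - weight x ⊤, so that
-- a polymatroid becomes the projection of a base polytope.
record Presents {n} (P : PSet n) (F : SetFunction (suc n)) : Set where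
  field
    submodular  : Submodular F
    normalised  : F ⊥ ≡ 0ℚ
    sound       : ∀ {x} → P x → Polymatroid F x
    convex      : Convex P
    extensional : Extensional P
    vertices    : ∀ {ℓ} → Injectiveℕ ℓ → P (λ i → vertex ℓ F (suc i))

open Presents

-- Soundness of the first presentation lifts the point into the base polytope of `G`; convexity and
-- the greedy vertices of the second bring it into `Q`. Used in both directions, this gives equality
-- of the two sets.
presents-⊆ : ∀ {n} {P Q : PSet n} {F G} → Presents P F → Presents Q G → (∀ K → F K ≡ G K) →
  ∀ {x} → P x → Q x
presents-⊆ {Q = Q} {F} {G} pres pres′ F≡G {x} Px =
  let x₀ , x≤F , x⊤ = sound pres Px in
  -- The convex set is the cylinder over `Q`, in which the slack coordinate is free.
  basePolytope⊆ {F = G} (submodular pres′) {P = λ y → Q (λ i → y (suc i))}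
    (convex pres′) (λ y≈z → extensional pres′ (λ i → y≈z (suc i))) (vertices pres′) (normalised pres′)
    {x₀ ◂ x} ((λ K → subst (weight (x₀ ◂ x) K ≤_) (F≡G K) (x≤F K)) , trans x⊤ (F≡G ⊤))

weight-combination : ∀ {m l} (w : Fin l → ℚ) (y : Fin l → Point m) {x : Point m} →
  (∀ i → x i ≡ sumFin l (λ k → w k * y k i)) →
  ∀ K → weight x K ≡ sumFin l (λ k → w k * weight (y k) K)
weight-combination {m} {l} w y {x} x≈ K = begin
  weight x K
    ≡⟨ sumFin-cong (λ i → trans (cong (indicator K i *_) (x≈ i))
         (trans (sym (sumFin-* (indicator K i) (λ k → w k * y k i)))
           (sumFin-cong (λ k → shuffle (indicator K i) (w k) (y k i))))) ⟩
  sumFin m (λ i → sumFin l (λ k → w k * (indicator K i * y k i)))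
    ≡⟨ sumFin-swap (λ i k → w k * (indicator K i * y k i)) ⟩
  sumFin l (λ k → sumFin m (λ i → w k * (indicator K i * y k i)))
    ≡⟨ sumFin-cong (λ k → sumFin-* (w k) (λ i → indicator K i * y k i)) ⟩
  sumFin l (λ k → w k * weight (y k) K) ∎
  where
  open ≡-Reasoning
  shuffle : ∀ k w y → k * (w * y) ≡ w * (k * y)
  shuffle = solve-∀ ℚ-ring

sumFin-*ʳ : ∀ {l} (w : Fin l → ℚ) c → sumFin l (λ k → w k * c) ≡ sumFin l w * c
sumFin-*ʳ {l} w c = trans (sumFin-cong (λ k → *-comm (w k) c)) (trans (sumFin-* c w) (*-comm c (sumFin l w)))

conv-sound : ∀ {n} {ps : List (Point n)} {F} → (∀ {p} → p ∈ ps → Polymatroid F p) →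
  ∀ {x} → conv ps x → Polymatroid F x
conv-sound {n} {ps} {F} vertex-sound {x} (w , 0≤w , Σw≡1 , x≡) = x₀ , x≤F , x⊤
  where
  l = List.length ps

  p∈ : ∀ k → Polymatroid F (List.lookup ps k)
  p∈ k = vertex-sound (∈-lookup k)

  y : Fin l → Point (suc n)
  y k = proj₁ (p∈ k) ◂ List.lookup ps k

  -- The slack is averaged with the same weights as the vertices, so the lifted point is a convex
  -- combination of lifted vertices.
  x₀ : ℚ
  x₀ = sumFin l (λ k → w k * y k zero)

  combination : ∀ i → (x₀ ◂ x) i ≡ sumFin l (λ k → w k * y k i)
  combination zero    = refl
  combination (suc i) = x≡ i

  average : ∀ c → sumFin l (λ k → w k * c) ≡ c
  average c = trans (sumFin-*ʳ w c) (trans (cong (_* c) Σw≡1) (*-identityˡ c))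

  x≤F : ∀ K → weight (x₀ ◂ x) K ≤ F K
  x≤F K = begin
    weight (x₀ ◂ x) K                     ≡⟨ weight-combination w y combination K ⟩
    sumFin l (λ k → w k * weight (y k) K) ≤⟨ sumFin-mono (λ k → *-monoˡ (0≤w k) (proj₁ (proj₂ (p∈ k)) K)) ⟩
    sumFin l (λ k → w k * F K)            ≡⟨ average (F K) ⟩
    F K ∎
    where open ≤-Reasoning

  x⊤ : weight (x₀ ◂ x) ⊤ ≡ F ⊤
  x⊤ = begin
    weight (x₀ ◂ x) ⊤                     ≡⟨ weight-combination w y combination ⊤ ⟩
    sumFin l (λ k → w k * weight (y k) ⊤) ≡⟨ sumFin-cong (λ k → cong (w k *_) (proj₂ (proj₂ (p∈ k)))) ⟩
    sumFin l (λ k → w k * F ⊤)            ≡⟨ average (F ⊤) ⟩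
    F ⊤ ∎
    where open ≡-Reasoning

conv-extensional : ∀ {n} (ps : List (Point n)) → Extensional (conv ps)
conv-extensional ps p≈q (w , 0≤w , Σw≡1 , p≡) = w , 0≤w , Σw≡1 , λ i → trans (sym (p≈q i)) (p≡ i)

conv-convex : ∀ {n} (ps : List (Point n)) → Convex (conv ps)
conv-convex ps {p} {q} s t 0≤s 0≤t s+t≡1 (w , 0≤w , Σw≡1 , p≡) (w′ , 0≤w′ , Σw′≡1 , q≡) =
  (λ k → s * w k + t * w′ k) ,
  (λ k → 0≤+ (0≤* 0≤s (0≤w k)) (0≤* 0≤t (0≤w′ k))) ,
  trans (sumFin-lin s t w w′) (trans (cong₂ (λ a b → s * a + t * b) Σw≡1 Σw′≡1)
    (trans (cong₂ _+_ (*-identityʳ s) (*-identityʳ t)) s+t≡1)) ,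
  λ i → trans (cong₂ (λ a b → s * a + t * b) (p≡ i) (q≡ i))
    (trans (sym (sumFin-lin s t (λ k → w k * List.lookup ps k i) (λ k → w′ k * List.lookup ps k i)))
      (sumFin-cong (λ k → regroup s t (w k) (w′ k) (List.lookup ps k i))))
  where
  regroup : ∀ s t w w′ y → s * (w * y) + t * (w′ * y) ≡ (s * w + t * w′) * y
  regroup = solve-∀ ℚ-ring

0≤bit : ∀ b → 0ℚ ≤ bit b
0≤bit true  = nonNegative⁻¹ 1ℚ
0≤bit false = ≤-refl

0≤basis : ∀ {m} (i j : Fin m) → 0ℚ ≤ basis i j
0≤basis i j with i Fin.≟ j
... | yes _ = nonNegative⁻¹ 1ℚ
... | no  _ = ≤-refl

-- Here `basis` serves as the vector of coefficients: all the weight sits at the position of `p` in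
-- the list.
∈⇒conv : ∀ {n} {ps : List (Point n)} {p} → p ∈ ps → conv ps p
∈⇒conv {ps = ps} {p} p∈ps = basis k , 0≤basis k ,
  trans (sumFin-cong (λ j → sym (*-identityˡ (basis k j)))) (sumFin-basis (λ _ → 1ℚ) k) ,
  λ i → trans (cong (λ q → q i) (lookup-index p∈ps))
    (trans (sym (sumFin-basis (λ j → List.lookup ps j i) k))
      (sumFin-cong (λ j → *-comm (List.lookup ps j i) (basis k j))))
  where
  k = index p∈ps

zero-presents : ∀ {n} → Presents (Zero {n}) (λ _ → 0ℚ)
zero-presents .submodular _ _ = ≤-refl
zero-presents .normalised = refl
zero-presents {n} .sound {x} x≈0 = 0ℚ , (λ K → ≤-reflexive (zero-weight K)) , zero-weight ⊤
  where
  zero-weight : ∀ K → weight (0ℚ ◂ x) K ≡ 0ℚ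
  zero-weight K = trans (weight-cong {x = 0ℚ ◂ x} {zeroPt} K λ { zero → refl ; (suc i) → x≈0 i }) (weight-0 K)
zero-presents .convex {p} {q} s t _ _ _ p≈0 q≈0 i =
  trans (cong₂ (λ a b → s * a + t * b) (p≈0 i) (q≈0 i)) (vanish s t)
  where
  vanish : ∀ s t → s * 0ℚ + t * 0ℚ ≡ 0ℚ
  vanish = solve-∀ ℚ-ring
zero-presents .extensional p≈q p≈0 i = trans (sym (p≈q i)) (p≈0 i)
zero-presents .vertices _ i = refl

module _ {n} {P Q : PSet n} {F G : SetFunction (suc n)} where

  ⊕-presents : Presents P F → Presents Q G → Presents (P ⊕ Q) (λ K → F K + G K)
  ⊕-presents presP presQ .submodular X Y = subst₂ _≤_
    (+-interchange (F (X ∪ Y)) (F (X ∩ Y)) (G (X ∪ Y)) (G (X ∩ Y)))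
    (+-interchange (F X) (F Y) (G X) (G Y))
    (+-mono-≤ (submodular presP X Y) (submodular presQ X Y))
  ⊕-presents presP presQ .normalised =
    trans (cong₂ _+_ (normalised presP) (normalised presQ)) (+-identityˡ 0ℚ)
  ⊕-presents presP presQ .sound {x} (p , q , Pp , Qq , x≈) =
    let p₀ , p≤F , p⊤ = sound presP Pp
        q₀ , q≤G , q⊤ = sound presQ Qq
        split : ∀ K → weight (p₀ + q₀ ◂ x) K ≡ weight (p₀ ◂ p) K + weight (q₀ ◂ q) K
        split K = trans (weight-cong {x = p₀ + q₀ ◂ x} {λ i → (p₀ ◂ p) i + (q₀ ◂ q) i} K
          (λ { zero → refl ; (suc i) → x≈ i })) (weight-+ (p₀ ◂ p) (q₀ ◂ q) K)
    in p₀ + q₀ , (λ K → subst (_≤ F K + G K) (sym (split K)) (+-mono-≤ (p≤F K) (q≤G K))) ,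
       trans (split ⊤) (cong₂ _+_ p⊤ q⊤)
  ⊕-presents presP presQ .convex {x} {x′} s t 0≤s 0≤t s+t≡1 (p , q , Pp , Qq , x≈) (p′ , q′ , Pp′ , Qq′ , x′≈) =
    (λ i → s * p i + t * p′ i) , (λ i → s * q i + t * q′ i) ,
    convex presP s t 0≤s 0≤t s+t≡1 Pp Pp′ , convex presQ s t 0≤s 0≤t s+t≡1 Qq Qq′ ,
    λ i → trans (cong₂ (λ a b → s * a + t * b) (x≈ i) (x′≈ i)) (regroup s t (p i) (q i) (p′ i) (q′ i))
    where
    regroup : ∀ s t p q p′ q′ → s * (p + q) + t * (p′ + q′) ≡ (s * p + t * p′) + (s * q + t * q′)
    regroup = solve-∀ ℚ-ring
  ⊕-presents presP presQ .extensional x≈y (p , q , Pp , Qq , x≈) =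
    p , q , Pp , Qq , λ i → trans (sym (x≈y i)) (x≈ i)
  -- One and the same order gives a greedy vertex in `P` and one in `Q`, and these two points
  -- witness membership in the Minkowski sum.
  ⊕-presents presP presQ .vertices {ℓ} inj =
    (λ i → vertex ℓ F (suc i)) , (λ i → vertex ℓ G (suc i)) , vertices presP inj , vertices presQ inj ,
    λ i → regroup (F (level ℓ (suc (ℓ (suc i))))) (G (level ℓ (suc (ℓ (suc i)))))
                  (F (level ℓ (ℓ (suc i)))) (G (level ℓ (ℓ (suc i))))
    where
    regroup : ∀ a b c d → (a + b) - (c + d) ≡ (a - c) + (b - d)
    regroup = solve-∀ ℚ-ring

·-presents : ∀ {n c} {Q : PSet n} {F} → 0ℚ ≤ c → Presents Q F → Presents (c · Q) (λ K → c * F K)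
·-presents {c = c} {F = F} 0≤c pres .submodular X Y = subst₂ _≤_
  (*-distribˡ-+ c (F (X ∪ Y)) (F (X ∩ Y))) (*-distribˡ-+ c (F X) (F Y))
  (*-monoˡ 0≤c (submodular pres X Y))
·-presents {c = c} 0≤c pres .normalised = trans (cong (c *_) (normalised pres)) (*-zeroʳ c)
·-presents {c = c} {F = F} 0≤c pres .sound {x} (q , Qq , x≈) =
  let q₀ , q≤F , q⊤ = sound pres Qq
      scale : ∀ K → weight (c * q₀ ◂ x) K ≡ c * weight (q₀ ◂ q) K
      scale K = trans (weight-cong {x = c * q₀ ◂ x} {λ i → c * (q₀ ◂ q) i} K
        (λ { zero → refl ; (suc i) → x≈ i })) (weight-* c (q₀ ◂ q) K)
  in c * q₀ , (λ K → subst (_≤ c * F K) (sym (scale K)) (*-monoˡ 0≤c (q≤F K))) ,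
     trans (scale ⊤) (cong (c *_) q⊤)
·-presents {c = c} 0≤c pres .convex {x} {x′} s t 0≤s 0≤t s+t≡1 (q , Qq , x≈) (q′ , Qq′ , x′≈) =
  (λ i → s * q i + t * q′ i) , convex pres s t 0≤s 0≤t s+t≡1 Qq Qq′ ,
  λ i → trans (cong₂ (λ a b → s * a + t * b) (x≈ i) (x′≈ i)) (regroup s t c (q i) (q′ i))
  where
  regroup : ∀ s t c q q′ → s * (c * q) + t * (c * q′) ≡ c * (s * q + t * q′)
  regroup = solve-∀ ℚ-ring
·-presents 0≤c pres .extensional x≈y (q , Qq , x≈) = q , Qq , λ i → trans (sym (x≈y i)) (x≈ i)
·-presents {c = c} {F = F} 0≤c pres .vertices {ℓ} inj = (λ i → vertex ℓ F (suc i)) , vertices pres inj ,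
  λ i → factor c (F (level ℓ (suc (ℓ (suc i))))) (F (level ℓ (ℓ (suc i))))
  where
  factor : ∀ c a b → c * a - c * b ≡ c * (a - b)
  factor = solve-∀ ℚ-ring

⨁-presents : ∀ {n} {A : Set} {P : A → PSet n} {F : A → SetFunction (suc n)} {as : List A} →
  All (λ a → Presents (P a) (F a)) as →
  Presents (⨁ (List.map P as)) (λ K → List.foldr _+_ 0ℚ (List.map (λ a → F a K) as))
⨁-presents []       = zero-presents
⨁-presents (p ∷ ps) = ⊕-presents p (⨁-presents ps)

-- The simplices D_J

meets : ∀ {m} → Subset m → Subset m → Bool
meets []      []      = false
meets (a ∷ X) (b ∷ Y) = (a ∧ b) ∨ meets X Y

meets⁺ : ∀ {m} (X Y : Subset m) i → lookup X i ≡ true → lookup Y i ≡ true → meets X Y ≡ true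
meets⁺ (true ∷ X) (true ∷ Y) zero refl refl = refl
meets⁺ (a ∷ X) (b ∷ Y) (suc i) Xi Yi with a ∧ b
... | true  = refl
... | false = meets⁺ X Y i Xi Yi

meets⁻ : ∀ {m} (X Y : Subset m) → meets X Y ≡ true → ∃ λ i → lookup X i ≡ true × lookup Y i ≡ true
meets⁻ []          []          ()
meets⁻ (true  ∷ X) (true  ∷ Y) h = zero , refl , refl
meets⁻ (true  ∷ X) (false ∷ Y) h = let i , hit = meets⁻ X Y h in suc i , hit
meets⁻ (false ∷ X) (_     ∷ Y) h = let i , hit = meets⁻ X Y h in suc i , hit

meets-∪ : ∀ {m} (J X Y : Subset m) → meets J (X ∪ Y) ≡ meets J X ∨ meets J Y
meets-∪ []          []          []          = refl
meets-∪ (false ∷ J) (_ ∷ X)     (_ ∷ Y)     = meets-∪ J X Y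
meets-∪ (true ∷ J)  (true ∷ X)  (_ ∷ Y)     = refl
meets-∪ (true ∷ J)  (false ∷ X) (false ∷ Y) = meets-∪ J X Y
meets-∪ (true ∷ J)  (false ∷ X) (true ∷ Y)  with meets J X
... | true  = refl
... | false = refl

meets-⊥ : ∀ {m} (J : Subset m) → meets J ⊥ ≡ false
meets-⊥ []          = refl
meets-⊥ (true  ∷ J) = meets-⊥ J
meets-⊥ (false ∷ J) = meets-⊥ J

bit-mono : ∀ a b → (a ≡ true → b ≡ true) → bit a ≤ bit b
bit-mono false b     h = 0≤bit b
bit-mono true  true  h = ≤-refl
bit-mono true  false h = contradiction (h refl) λ ()

-- Meeting a union is exactly a disjunction, whereas meeting an intersection only implies the
-- conjunction. The inequality comes from this one-sided implication.
meets-submodular : ∀ {m} (J : Subset m) → Submodular (λ K → bit (meets J K))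
meets-submodular J X Y = begin
  bit (meets J (X ∪ Y)) + bit (meets J (X ∩ Y))
    ≤⟨ +-mono-≤ (≤-reflexive (cong bit (meets-∪ J X Y))) (bit-mono (meets J (X ∩ Y)) (meets J X ∧ meets J Y) both) ⟩
  bit (meets J X ∨ meets J Y) + bit (meets J X ∧ meets J Y)
    ≡⟨ bit-modular (meets J X) (meets J Y) ⟩
  bit (meets J X) + bit (meets J Y) ∎
  where
  open ≤-Reasoning
  ∧-true : ∀ {a b} → a ∧ b ≡ true → a ≡ true × b ≡ true
  ∧-true {true} {true} _ = refl , refl
  both : meets J (X ∩ Y) ≡ true → meets J X ∧ meets J Y ≡ true
  both h with meets⁻ J (X ∩ Y) h
  ... | i , Ji , XYi with ∧-true (trans (sym (lookup-zipWith _∧_ i X Y)) XYi)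
  ... | Xi , Yi = cong₂ _∧_ (meets⁺ J X i Ji Xi) (meets⁺ J Y i Ji Yi)

basis∈BasePolytope : ∀ {m} (J : Subset m) i → lookup J i ≡ true → BasePolytope (λ K → bit (meets J K)) (basis i)
basis∈BasePolytope J i Ji =
  (λ K → subst (_≤ bit (meets J K)) (sym (weight-basis i K)) (bit-mono (lookup K i) (meets J K) (meets⁺ J K i Ji))) ,
  trans (weight-basis i ⊤) (cong bit (trans (lookup-replicate i inside)
    (sym (meets⁺ J ⊤ i Ji (lookup-replicate i inside)))))

Minimal : ∀ {m} → Subset m → (Fin m → ℕ) → Fin m → Set
Minimal J ℓ i = lookup J i ≡ true × (∀ {e} → lookup J e ≡ true → ℓ i ℕ.≤ ℓ e)

minimal : ∀ {m} (J : Subset m) (ℓ : Fin m → ℕ) i → lookup J i ≡ true → ∃ (Minimal J ℓ)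
minimal J ℓ i Ji = go i Ji (<-wellFounded (ℓ i))
  where
  go : ∀ i → lookup J i ≡ true → Acc ℕ._<_ (ℓ i) → ∃ (Minimal J ℓ)
  go i Ji (acc rs) with FinP.any? (λ e → (lookup J e Bool.≟ true) ×-dec (ℓ e ℕ.<? ℓ i))
  ... | yes (e , Je , ℓe<ℓi) = go e Je (rs ℓe<ℓi)
  ... | no none = i , Ji , λ {e} Je → ℕP.≮⇒≥ (λ ℓe<ℓi → none (e , Je , ℓe<ℓi))

≡true-ext : ∀ {a b : Bool} → (a ≡ true → b ≡ true) → (b ≡ true → a ≡ true) → a ≡ b
≡true-ext {true}          f g = sym (f refl)
≡true-ext {false} {true}  f g = g refl
≡true-ext {false} {false} f g = refl

<ᵇ≡true⇒< : ∀ {a b} → (a <ᵇ b) ≡ true → a ℕ.< b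
<ᵇ≡true⇒< {a} {b} eq = ℕP.<ᵇ⇒< a b (subst Bool.T (sym eq) _)

meets-level : ∀ {m} (J : Subset m) {ℓ i} → Minimal J ℓ i → ∀ s → meets J (level ℓ s) ≡ (ℓ i <ᵇ s)
meets-level J {ℓ} {i} (Ji , min) s = ≡true-ext
  (λ h → let e , Je , Le = meets⁻ J (level ℓ s) h in
    <⇒<ᵇ≡true {ℓ i} {s} (ℕP.≤-<-trans (min Je) (<ᵇ≡true⇒< {ℓ e} {s} (trans (sym (lookup-level ℓ s e)) Le))))
  (λ h → meets⁺ J (level ℓ s) i Ji (trans (lookup-level ℓ s i) h))

-- Along the chain the function jumps from 0 to 1 once, when the first element of `J` enters.
vertex-meets : ∀ {m} (J : Subset m) {ℓ i} → Injectiveℕ ℓ → Minimal J ℓ i →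
  vertex ℓ (λ K → bit (meets J K)) ≈ᵖ basis i
vertex-meets J {ℓ} {i} inj min e = trans (cong₂ (λ a b → bit a - bit b)
  (meets-level J {ℓ} {i} min (suc (ℓ e))) (meets-level J {ℓ} {i} min (ℓ e))) jump
  where
  jump : bit (ℓ i <ᵇ suc (ℓ e)) - bit (ℓ i <ᵇ ℓ e) ≡ basis i e
  jump with i Fin.≟ e
  ... | yes refl rewrite <⇒<ᵇ≡true (ℕP.n<1+n (ℓ i)) | ≮⇒<ᵇ≡false (ℕP.n≮n (ℓ i)) = refl
  ... | no i≢e rewrite <ᵇ-suc-≢ (λ eq → i≢e (inj eq)) = +-inverseʳ (bit (ℓ i <ᵇ ℓ e))

simplexVertices : ∀ {n} → Subset n → List (Point n)
simplexVertices {n} J = zeroPt ∷ List.map basis (List.filter (λ i → lookup J i Bool.≟ inside) (List.allFin n))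

-- The base polytope is the simplex spanned by the basis vectors of `J` and of the slack; forgetting
-- the slack coordinate sends the slack's vector to the origin. The slack also guarantees a first
-- element when `J` is empty.
D-presents : ∀ {n} (J : Subset n) → Presents (D J) (λ K → bit (meets (inside ∷ J) K))
D-presents J .submodular = meets-submodular (inside ∷ J)
D-presents J .normalised = cong bit (meets-⊥ (inside ∷ J))
D-presents {n} J .sound = conv-sound λ where
    (here refl) → 1ℚ , base zero (1ℚ ◂ zeroPt) refl λ { zero → refl ; (suc i) → refl }
    (there p∈) → vertex-sound p∈
  where
  base : ∀ i x → lookup (inside ∷ J) i ≡ true → x ≈ᵖ basis i → BasePolytope (λ K → bit (meets (inside ∷ J) K)) x
  base i x Ji x≈ with basis∈BasePolytope (inside ∷ J) i Ji
  ... | ≤F , ⊤≡ = (λ K → subst (_≤ bit (meets (inside ∷ J) K)) (sym (weight-cong {x = x} {basis i} K x≈)) (≤F K)) ,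
    trans (weight-cong {x = x} {basis i} ⊤ x≈) ⊤≡
  vertex-sound : ∀ {p} → p ∈ List.map basis (List.filter (λ i → lookup J i Bool.≟ inside) (List.allFin n)) →
    Polymatroid (λ K → bit (meets (inside ∷ J) K)) p
  vertex-sound p∈ with ∈-map⁻ basis p∈
  ... | i , i∈ , refl = 0ℚ , base (suc i) (0ℚ ◂ basis i) (proj₂ (∈-filter⁻ (λ i → lookup J i Bool.≟ inside) {xs = List.allFin n} i∈))
    λ { zero → refl ; (suc e) → sym (basis-suc i e) }
D-presents J .convex = conv-convex (simplexVertices J)
D-presents J .extensional = conv-extensional (simplexVertices J)
D-presents J .vertices {ℓ} inj with minimal (inside ∷ J) ℓ zero refl
-- If the slack precedes all of `J`, the projected vertex is the origin; otherwise it is the basis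
-- vector of the first element of `J`.
... | zero , min = conv-extensional (simplexVertices J)
  (λ i → sym (vertex-meets (inside ∷ J) {ℓ} inj min (suc i))) (∈⇒conv {ps = simplexVertices J} (here refl))
... | suc k , min = conv-extensional (simplexVertices J)
  (λ i → sym (trans (vertex-meets (inside ∷ J) {ℓ} inj min (suc i)) (basis-suc k i)))
  (∈⇒conv {ps = simplexVertices J} (there (∈-map⁺ basis (∈-filter⁺ (λ i → lookup J i Bool.≟ inside) (∈-allFin k) (proj₁ min)))))

-- The independent set polytope

fromℕ : ℕ → ℚ
fromℕ k = toℚ (ℤ.+ k)

fromℕ-+ : ∀ a b → fromℕ (a ℕ.+ b) ≡ fromℕ a + fromℕ b
fromℕ-+ a b = toℚ-+ (ℤ.+ a) (ℤ.+ b)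

fromℕ-mono : ∀ {a b} → a ℕ.≤ b → fromℕ a ≤ fromℕ b
fromℕ-mono a≤b = toℚ-mono (ℤ.+≤+ a≤b)

∣p∪q∣≤∣p∣+∣q∣ : ∀ {n} (p q : Subset n) → ∣ p ∪ q ∣ ℕ.≤ ∣ p ∣ ℕ.+ ∣ q ∣
∣p∪q∣≤∣p∣+∣q∣ []            []            = ℕ.z≤n
∣p∪q∣≤∣p∣+∣q∣ (outside ∷ p) (outside ∷ q) = ∣p∪q∣≤∣p∣+∣q∣ p q
∣p∪q∣≤∣p∣+∣q∣ (outside ∷ p) (inside  ∷ q) = ℕP.≤-trans (ℕ.s≤s (∣p∪q∣≤∣p∣+∣q∣ p q)) (ℕP.≤-reflexive (sym (ℕP.+-suc _ _)))
∣p∪q∣≤∣p∣+∣q∣ (inside  ∷ p) (outside ∷ q) = ℕ.s≤s (∣p∪q∣≤∣p∣+∣q∣ p q)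
∣p∪q∣≤∣p∣+∣q∣ (inside  ∷ p) (inside  ∷ q) = ℕ.s≤s (ℕP.≤-trans (∣p∪q∣≤∣p∣+∣q∣ p q) (ℕP.+-monoʳ-≤ _ (ℕP.n≤1+n _)))

∣p∣≡∣p∩q∣+∣p∩∁q∣ : ∀ {n} (p q : Subset n) → ∣ p ∣ ≡ ∣ p ∩ q ∣ ℕ.+ ∣ p ∩ ∁ q ∣
∣p∣≡∣p∩q∣+∣p∩∁q∣ []            []            = refl
∣p∣≡∣p∩q∣+∣p∩∁q∣ (outside ∷ p) (_       ∷ q) = ∣p∣≡∣p∩q∣+∣p∩∁q∣ p q
∣p∣≡∣p∩q∣+∣p∩∁q∣ (inside  ∷ p) (inside  ∷ q) = cong suc (∣p∣≡∣p∩q∣+∣p∩∁q∣ p q)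
∣p∣≡∣p∩q∣+∣p∩∁q∣ (inside  ∷ p) (outside ∷ q) = trans (cong suc (∣p∣≡∣p∩q∣+∣p∩∁q∣ p q)) (sym (ℕP.+-suc _ _))

weight-indicator : ∀ {n} (I K : Subset n) → weight (indicator I) K ≡ fromℕ ∣ I ∩ K ∣
weight-indicator []            []            = refl
weight-indicator (true  ∷ I) (true  ∷ K) =
  trans (cong₂ _+_ (*-identityˡ 1ℚ) (weight-indicator I K)) (sym (fromℕ-+ 1 ∣ I ∩ K ∣))
weight-indicator (true  ∷ I) (false ∷ K) =
  trans (cong₂ _+_ (*-zeroˡ 1ℚ) (weight-indicator I K)) (+-identityˡ (fromℕ ∣ I ∩ K ∣))
weight-indicator (false ∷ I) (b ∷ K) =
  trans (cong₂ _+_ (*-zeroʳ (bit b)) (weight-indicator I K)) (+-identityˡ (fromℕ ∣ I ∩ K ∣))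

module _ {n} (M : Matroid n) where

  private
    ρ : Subset n → ℕ
    ρ = r M

  -- The slack by itself already has full rank. Its constraints, combined with equality on `⊤`, say
  -- that the weight of every complement is nonnegative; the sets without the slack give the rank
  -- bounds.
  coneRank : Subset (suc n) → ℕ
  coneRank (outside ∷ K) = ρ K
  coneRank (inside  ∷ K) = ρ ⊤

  coneRank-submodular : ∀ X Y → coneRank (X ∪ Y) ℕ.+ coneRank (X ∩ Y) ℕ.≤ coneRank X ℕ.+ coneRank Y
  coneRank-submodular (outside ∷ X) (outside ∷ Y) = r-submod M X Y
  coneRank-submodular (outside ∷ X) (inside  ∷ Y) = ℕP.≤-trans
    (ℕP.+-monoʳ-≤ (ρ ⊤) (r-mono M (p∩q⊆p X Y))) (ℕP.≤-reflexive (ℕP.+-comm (ρ ⊤) (ρ X)))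
  coneRank-submodular (inside  ∷ X) (outside ∷ Y) = ℕP.+-monoʳ-≤ (ρ ⊤) (r-mono M (p∩q⊆q X Y))
  coneRank-submodular (inside  ∷ X) (inside  ∷ Y) = ℕP.≤-refl

  r-⊥ : ρ ⊥ ≡ 0
  r-⊥ = ℕP.n≤0⇒n≡0 (subst (ρ ⊥ ℕ.≤_) (∣⊥∣≡0 n) (r-bounded M ⊥))

  -- `I` is covered by `K` and `I ∩ ∁ K`, so its rank is at most `ρ K` plus the size of `I ∩ ∁ K`.
  -- As the rank of `I` is its size, that part cancels.
  independent-∩ : ∀ {I} → Independent M I → ∀ K → ∣ I ∩ K ∣ ℕ.≤ ρ K
  independent-∩ {I} ind K = ℕP.+-cancelʳ-≤ ∣ I ∩ ∁ K ∣ _ _ (begin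
    ∣ I ∩ K ∣ ℕ.+ ∣ I ∩ ∁ K ∣ ≡⟨ ∣p∣≡∣p∩q∣+∣p∩∁q∣ I K ⟨
    ∣ I ∣                            ≡⟨ ind ⟨
    ρ I                                     ≤⟨ r-mono M cover ⟩
    ρ (K ∪ (I ∩ ∁ K))                       ≤⟨ ℕP.m≤m+n _ _ ⟩
    ρ (K ∪ (I ∩ ∁ K)) ℕ.+ ρ (K ∩ (I ∩ ∁ K)) ≤⟨ r-submod M K (I ∩ ∁ K) ⟩
    ρ K ℕ.+ ρ (I ∩ ∁ K)                     ≤⟨ ℕP.+-monoʳ-≤ (ρ K) (r-bounded M (I ∩ ∁ K)) ⟩
    ρ K ℕ.+ ∣ I ∩ ∁ K ∣              ∎)
    where
    open ℕP.≤-Reasoning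
    cover : I ⊆ K ∪ (I ∩ ∁ K)
    cover {e} e∈I with e ∈? K
    ... | yes e∈K = x∈p∪q⁺ (inj₁ e∈K)
    ... | no  e∉K = x∈p∪q⁺ (inj₂ (x∈p∩q⁺ (e∈I , x∉p⇒x∈∁p e∉K)))

  rankFunction : SetFunction (suc n)
  rankFunction K = fromℕ (coneRank K)

  independent-sound : ∀ {I} → Independent M I → Polymatroid rankFunction (indicator I)
  independent-sound {I} ind = x₀ , ≤F , ⊤≡
    where
    x₀ : ℚ
    -- This value is forced by the equation on `⊤`.
    x₀ = fromℕ (ρ ⊤) - fromℕ ∣ I ∣

    weight-outside : ∀ K → weight (x₀ ◂ indicator I) (outside ∷ K) ≡ fromℕ ∣ I ∩ K ∣
    weight-outside K = trans (cong₂ _+_ (*-zeroˡ x₀) (weight-indicator I K)) (+-identityˡ (fromℕ ∣ I ∩ K ∣))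

    weight-inside : ∀ K → weight (x₀ ◂ indicator I) (inside ∷ K) ≡ x₀ + fromℕ ∣ I ∩ K ∣
    weight-inside K = cong₂ _+_ (*-identityˡ x₀) (weight-indicator I K)

    fill : ∀ a b → (a - b) + b ≡ a
    fill = solve-∀ ℚ-ring

    ≤F : ∀ K → weight (x₀ ◂ indicator I) K ≤ rankFunction K
    ≤F (outside ∷ K) = subst (_≤ fromℕ (ρ K)) (sym (weight-outside K)) (fromℕ-mono (independent-∩ ind K))
    ≤F (inside  ∷ K) = begin
      weight (x₀ ◂ indicator I) (inside ∷ K) ≡⟨ weight-inside K ⟩
      x₀ + fromℕ ∣ I ∩ K ∣            ≤⟨ +-monoʳ-≤ x₀ (fromℕ-mono (∣p∩q∣≤∣p∣ I K)) ⟩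
      x₀ + fromℕ ∣ I ∣                ≡⟨ fill (fromℕ (ρ ⊤)) (fromℕ ∣ I ∣) ⟩
      fromℕ (ρ ⊤)                            ∎
      where open ≤-Reasoning

    ⊤≡ : weight (x₀ ◂ indicator I) ⊤ ≡ rankFunction ⊤
    ⊤≡ = begin
      weight (x₀ ◂ indicator I) (inside ∷ ⊤) ≡⟨ weight-inside ⊤ ⟩
      x₀ + fromℕ ∣ I ∩ ⊤ ∣            ≡⟨ cong (λ X → x₀ + fromℕ ∣ X ∣) (∩-identityʳ I) ⟩
      x₀ + fromℕ ∣ I ∣                ≡⟨ fill (fromℕ (ρ ⊤)) (fromℕ ∣ I ∣) ⟩
      fromℕ (ρ ⊤)                            ∎
      where open ≡-Reasoning

-- Greedy vertices of the rank function

∈-level⁺ : ∀ {m} (ℓ : Fin m → ℕ) {s e} → ℓ e ℕ.< s → e Subset.∈ level ℓ s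
∈-level⁺ ℓ {s} {e} lt = lookup⇒[]= e (level ℓ s) (trans (lookup-level ℓ s e) (<⇒<ᵇ≡true {ℓ e} {s} lt))

∈-level⁻ : ∀ {m} (ℓ : Fin m → ℕ) {s e} → e Subset.∈ level ℓ s → ℓ e ℕ.< s
∈-level⁻ ℓ {s} {e} e∈ = <ᵇ≡true⇒< {ℓ e} {s} (trans (sym (lookup-level ℓ s e)) ([]=⇒lookup e∈))

bounded : ∀ {m} (ℓ : Fin m → ℕ) → ∃ λ s → ∀ e → ℓ e ℕ.< s
bounded {zero}  ℓ = 0 , λ ()
bounded {suc m} ℓ with bounded (λ e → ℓ (suc e))
... | s , lt = suc (ℓ zero) ℕ.⊔ s , λ where
  zero    → ℕP.m≤m⊔n (suc (ℓ zero)) s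
  (suc e) → ℕP.≤-trans (lt e) (ℕP.m≤n⊔m (suc (ℓ zero)) s)

bit-jump : ∀ {a b} → a ℕ.≤ b → b ℕ.≤ suc a → fromℕ b - fromℕ a ≡ bit (a <ᵇ b)
bit-jump {a} {b} a≤b b≤1+a with a ℕ.<? b
... | no a≮b rewrite ≮⇒<ᵇ≡false a≮b | ℕP.≤-antisym a≤b (ℕP.≮⇒≥ a≮b) = +-inverseʳ (fromℕ b)
... | yes a<b rewrite <⇒<ᵇ≡true a<b | ℕP.≤-antisym b≤1+a a<b =
  trans (cong (_- fromℕ a) (fromℕ-+ 1 a)) (p+q-q≡p 1ℚ (fromℕ a))

module _ {n} (M : Matroid n) {ℓ : Fin (suc n) → ℕ} (inj : Injectiveℕ ℓ) where

  private
    ρ : Subset n → ℕ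
    ρ = r M

    κ : Fin n → ℕ
    κ e = ℓ (suc e)

    lower upper : Fin n → ℕ
    lower e = coneRank M (level ℓ (κ e))
    upper e = coneRank M (level ℓ (suc (κ e)))

    level-suc-⊆ : ∀ e → level κ (suc (κ e)) ⊆ level κ (κ e) ∪ ⁅ e ⁆
    level-suc-⊆ e {e′} e′∈ with κ e′ ℕ.<? κ e
    ... | yes lt = x∈p∪q⁺ (inj₁ (∈-level⁺ κ lt))
    ... | no ge with FinP.suc-injective (inj (ℕP.≤-antisym (ℕ.s≤s⁻¹ (∈-level⁻ κ e′∈)) (ℕP.≮⇒≥ ge)))
    ... | refl = x∈p∪q⁺ (inj₂ (x∈⁅x⁆ e))

    level-⊆-suc : ∀ s → level κ s ⊆ level κ (suc s)
    level-⊆-suc s e∈ = ∈-level⁺ κ (ℕP.m<n⇒m<1+n (∈-level⁻ κ e∈))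

    -- Once the slack element zero has been passed, coneRank stays at its maximum.
    jumps : ∀ e → upper e ≡ lower e ⊎ (lower e ≡ ρ (level κ (κ e)) × upper e ≡ ρ (level κ (suc (κ e))))
    jumps e rewrite <ᵇ-suc-≢ {ℓ zero} {ℓ (suc e)} (λ eq → FinP.0≢1+n (inj eq)) with ℓ zero <ᵇ ℓ (suc e)
    ... | true  = inj₁ refl
    ... | false = inj₂ (refl , refl)

    lower≤upper : ∀ e → lower e ℕ.≤ upper e
    lower≤upper e with jumps e
    ... | inj₁ eq = ℕP.≤-reflexive (sym eq)
    ... | inj₂ (lo , up) rewrite lo | up = r-mono M (level-⊆-suc (κ e))

    upper≤1+lower : ∀ e → upper e ℕ.≤ suc (lower e)
    upper≤1+lower e with jumps e
    ... | inj₁ eq = ℕP.≤-trans (ℕP.≤-reflexive eq) (ℕP.n≤1+n _)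
    ... | inj₂ (lo , up) rewrite lo | up = begin
      ρ (level κ (suc (κ e)))                                  ≤⟨ r-mono M (level-suc-⊆ e) ⟩
      ρ (level κ (κ e) ∪ ⁅ e ⁆)                                ≤⟨ ℕP.m≤m+n _ _ ⟩
      ρ (level κ (κ e) ∪ ⁅ e ⁆) ℕ.+ ρ (level κ (κ e) ∩ ⁅ e ⁆)  ≤⟨ r-submod M (level κ (κ e)) ⁅ e ⁆ ⟩
      ρ (level κ (κ e)) ℕ.+ ρ ⁅ e ⁆                            ≤⟨ ℕP.+-monoʳ-≤ _ (r-bounded M ⁅ e ⁆) ⟩
      ρ (level κ (κ e)) ℕ.+ ∣ ⁅ e ⁆ ∣                   ≡⟨ cong (ρ (level κ (κ e)) ℕ.+_) (∣⁅x⁆∣≡1 e) ⟩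
      ρ (level κ (κ e)) ℕ.+ 1                                  ≡⟨ ℕP.+-comm _ 1 ⟩
      suc (ρ (level κ (κ e)))                                  ∎
      where open ℕP.≤-Reasoning

  -- The elements whose arrival raises the rank, as in the greedy algorithm for a basis. Elements
  -- arriving after the slack never do, which is how independent sets that are not bases arise.
  greedySet : Subset n
  greedySet = tabulate (λ e → lower e <ᵇ upper e)

  private
    I = greedySet

    ∈I⇒jump : ∀ {e} → e Subset.∈ I → ρ (level κ (κ e)) ℕ.< ρ (level κ (suc (κ e)))
    ∈I⇒jump {e} e∈I with jumps e
      | <ᵇ≡true⇒< {lower e} {upper e} (trans (sym (lookup∘tabulate (λ e → lower e <ᵇ upper e) e)) ([]=⇒lookup e∈I))
    ... | inj₁ eq        | lt = contradiction (sym eq) (ℕP.<⇒≢ lt)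
    ... | inj₂ (lo , up) | lt = subst₂ ℕ._<_ lo up lt

    -- If `e` is rejected, the trace of `I` does not grow. If it is accepted, the rank jumps from
    -- `L` to `L⁺`; submodularity on `L` and `Y = I ∩ L⁺`, whose union contains `L⁺` and whose
    -- intersection contains `I ∩ L`, transfers this jump to the smaller pair `I ∩ L` and `Y`.
    greedy-step : ∀ e → ∣ I ∩ level κ (κ e) ∣ ℕ.≤ ρ (I ∩ level κ (κ e)) →
      ∣ I ∩ level κ (suc (κ e)) ∣ ℕ.≤ ρ (I ∩ level κ (suc (κ e)))
    greedy-step e ih with e ∈? I
    ... | no e∉I = ℕP.≤-trans (p⊆q⇒∣p∣≤∣q∣ shrink) (ℕP.≤-trans ih (r-mono M grow))
      where
      shrink : I ∩ level κ (suc (κ e)) ⊆ I ∩ level κ (κ e)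
      shrink e′∈ with x∈p∩q⁻ I (level κ (suc (κ e))) e′∈
      ... | e′∈I , e′∈L with x∈p∪q⁻ (level κ (κ e)) ⁅ e ⁆ (level-suc-⊆ e e′∈L)
      ... | inj₁ e′∈L′ = x∈p∩q⁺ (e′∈I , e′∈L′)
      ... | inj₂ e′∈e with x∈⁅y⁆⇒x≡y e e′∈e
      ... | refl = contradiction e′∈I e∉I
      grow : I ∩ level κ (κ e) ⊆ I ∩ level κ (suc (κ e))
      grow e′∈ with x∈p∩q⁻ I (level κ (κ e)) e′∈
      ... | e′∈I , e′∈L = x∈p∩q⁺ (e′∈I , level-⊆-suc (κ e) e′∈L)
    ... | yes e∈I = ℕP.≤-trans card (ℕP.≤-trans (ℕ.s≤s ih) rank)
      where
      L L⁺ Y : Subset n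
      L = level κ (κ e)
      L⁺ = level κ (suc (κ e))
      Y = I ∩ L⁺

      Y⊆ : Y ⊆ (I ∩ L) ∪ ⁅ e ⁆
      Y⊆ e′∈ with x∈p∩q⁻ I L⁺ e′∈
      ... | e′∈I , e′∈L⁺ with x∈p∪q⁻ L ⁅ e ⁆ (level-suc-⊆ e e′∈L⁺)
      ... | inj₁ e′∈L = x∈p∪q⁺ (inj₁ (x∈p∩q⁺ (e′∈I , e′∈L)))
      ... | inj₂ e′∈e = x∈p∪q⁺ (inj₂ e′∈e)

      card : ∣ Y ∣ ℕ.≤ suc ∣ I ∩ L ∣
      card = begin
        ∣ Y ∣                               ≤⟨ p⊆q⇒∣p∣≤∣q∣ Y⊆ ⟩
        ∣ (I ∩ L) ∪ ⁅ e ⁆ ∣                 ≤⟨ ∣p∪q∣≤∣p∣+∣q∣ (I ∩ L) ⁅ e ⁆ ⟩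
        ∣ I ∩ L ∣ ℕ.+ ∣ ⁅ e ⁆ ∣      ≡⟨ cong (∣ I ∩ L ∣ ℕ.+_) (∣⁅x⁆∣≡1 e) ⟩
        ∣ I ∩ L ∣ ℕ.+ 1                     ≡⟨ ℕP.+-comm _ 1 ⟩
        suc ∣ I ∩ L ∣                       ∎
        where open ℕP.≤-Reasoning

      L⁺⊆ : L⁺ ⊆ L ∪ Y
      L⁺⊆ e′∈ with x∈p∪q⁻ L ⁅ e ⁆ (level-suc-⊆ e e′∈)
      ... | inj₁ e′∈L = x∈p∪q⁺ (inj₁ e′∈L)
      ... | inj₂ e′∈e with x∈⁅y⁆⇒x≡y e e′∈e
      ... | refl = x∈p∪q⁺ (inj₂ (x∈p∩q⁺ (e∈I , e′∈)))

      ⊆L∩Y : I ∩ L ⊆ L ∩ Y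
      ⊆L∩Y e′∈ with x∈p∩q⁻ I L e′∈
      ... | e′∈I , e′∈L = x∈p∩q⁺ (e′∈L , x∈p∩q⁺ (e′∈I , level-⊆-suc (κ e) e′∈L))

      rank : suc (ρ (I ∩ L)) ℕ.≤ ρ Y
      rank = ℕP.+-cancelˡ-≤ (ρ L) _ _ (begin
        ρ L ℕ.+ suc (ρ (I ∩ L))   ≡⟨ ℕP.+-suc (ρ L) (ρ (I ∩ L)) ⟩
        suc (ρ L) ℕ.+ ρ (I ∩ L)   ≤⟨ ℕP.+-mono-≤ (ℕP.≤-trans (∈I⇒jump e∈I) (r-mono M L⁺⊆)) (r-mono M ⊆L∩Y) ⟩
        ρ (L ∪ Y) ℕ.+ ρ (L ∩ Y)   ≤⟨ r-submod M L Y ⟩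
        ρ L ℕ.+ ρ Y               ∎)
        where open ℕP.≤-Reasoning

    greedy-below : ∀ s → ∣ I ∩ level κ s ∣ ℕ.≤ ρ (I ∩ level κ s)
    greedy-below zero = ℕP.≤-trans (∣p∩q∣≤∣q∣ I (level κ 0))
      (ℕP.≤-trans (ℕP.≤-reflexive (trans (cong ∣_∣ (level-zero κ)) (∣⊥∣≡0 n))) ℕ.z≤n)
    greedy-below (suc s) with FinP.any? (λ e → κ e ℕ.≟ s)
    ... | yes (e , κe≡s) = subst (λ t → ∣ I ∩ level κ (suc t) ∣ ℕ.≤ ρ (I ∩ level κ (suc t))) κe≡s
      (greedy-step e (subst (λ t → ∣ I ∩ level κ t ∣ ℕ.≤ ρ (I ∩ level κ t)) (sym κe≡s) (greedy-below s)))
    -- Label `s` is a gap, so the level is the same as before.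
    ... | no none = subst (λ L → ∣ I ∩ L ∣ ℕ.≤ ρ (I ∩ L))
      (tabulate-cong (λ e → sym (<ᵇ-suc-≢ (λ κe≡s → none (e , κe≡s))))) (greedy-below s)

  greedySet-independent : Independent M greedySet
  greedySet-independent = ℕP.≤-antisym (r-bounded M I)
    (subst (λ X → ∣ X ∣ ℕ.≤ ρ X) (trans (cong (I ∩_) level≡⊤) (∩-identityʳ I)) (greedy-below s))
    where
    s = proj₁ (bounded κ)
    level≡⊤ : level κ s ≡ ⊤
    level≡⊤ = subset-ext (λ e → trans (lookup-level κ s e)
      (trans (<⇒<ᵇ≡true (proj₂ (bounded κ) e)) (sym (lookup-replicate e inside))))

  vertex-rank : ∀ e → indicator greedySet e ≡ vertex ℓ (rankFunction M) (suc e)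
  vertex-rank e = trans (cong bit (lookup∘tabulate (λ e → lower e <ᵇ upper e) e))
    (sym (bit-jump (lower≤upper e) (upper≤1+lower e)))

∈-allSubsets : ∀ {n} (X : Subset n) → X ∈ allSubsets n
∈-allSubsets []            = here refl
∈-allSubsets (outside ∷ X) = ∈-concatMap⁺ _ (Any.map (λ { refl → here refl }) (∈-allSubsets X))
∈-allSubsets (inside  ∷ X) = ∈-concatMap⁺ _ (Any.map (λ { refl → there (here refl) }) (∈-allSubsets X))

independentIndicators : ∀ {n} → Matroid n → List (Point n)
independentIndicators {n} M = List.map indicator (List.filter (independent? M) (allSubsets n))

IM-presents : ∀ {n} (M : Matroid n) → Presents (IM M) (rankFunction M)
IM-presents M .submodular X Y = subst₂ _≤_ (fromℕ-+ (coneRank M (X ∪ Y)) (coneRank M (X ∩ Y)))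
  (fromℕ-+ (coneRank M X) (coneRank M Y)) (fromℕ-mono (coneRank-submodular M X Y))
IM-presents M .normalised = cong fromℕ (r-⊥ M)
IM-presents {n} M .sound = conv-sound vertex-sound
  where
  vertex-sound : ∀ {p} → p ∈ independentIndicators M → Polymatroid (rankFunction M) p
  vertex-sound p∈ with ∈-map⁻ indicator p∈
  ... | I , I∈ , refl = independent-sound M (proj₂ (∈-filter⁻ (independent? M) {xs = allSubsets n} I∈))
IM-presents M .convex = conv-convex (independentIndicators M)
IM-presents M .extensional = conv-extensional (independentIndicators M)
IM-presents M .vertices inj = conv-extensional (independentIndicators M) (vertex-rank M inj)
  (∈⇒conv {ps = independentIndicators M} (∈-map⁺ indicator
    (∈-filter⁺ (independent? M) (∈-allSubsets (greedySet M inj)) (greedySet-independent M inj))))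

-- Möbius inversion

bitℤ : Bool → ℤ
bitℤ b = if b then ℤ.+ 1 else ℤ.+ 0

sumSubsets : ∀ n → (Subset n → ℤ) → ℤ
sumSubsets n f = sumℤ (List.map f (allSubsets n))

sumℤ-cong : ∀ {A : Set} {f g : A → ℤ} → (∀ a → f a ≡ g a) → ∀ as → sumℤ (List.map f as) ≡ sumℤ (List.map g as)
sumℤ-cong f≡g []       = refl
sumℤ-cong f≡g (a ∷ as) = cong₂ ℤ._+_ (f≡g a) (sumℤ-cong f≡g as)

sumℤ-lin : ∀ {A : Set} c d (f g : A → ℤ) as →
  sumℤ (List.map (λ a → c ℤ.* f a ℤ.+ d ℤ.* g a) as) ≡ c ℤ.* sumℤ (List.map f as) ℤ.+ d ℤ.* sumℤ (List.map g as)
sumℤ-lin c d f g [] = zeros c d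
  where
  zeros : ∀ c d → ℤ.+ 0 ≡ c ℤ.* (ℤ.+ 0) ℤ.+ d ℤ.* (ℤ.+ 0)
  zeros = ℤ-Solver.solve-∀
sumℤ-lin c d f g (a ∷ as) = trans (cong (ℤ._+_ (c ℤ.* f a ℤ.+ d ℤ.* g a)) (sumℤ-lin c d f g as))
  (regroup c d (f a) (g a) (sumℤ (List.map f as)) (sumℤ (List.map g as)))
  where
  regroup : ∀ c d x y X Y → (c ℤ.* x ℤ.+ d ℤ.* y) ℤ.+ (c ℤ.* X ℤ.+ d ℤ.* Y) ≡ c ℤ.* (x ℤ.+ X) ℤ.+ d ℤ.* (y ℤ.+ Y)
  regroup = ℤ-Solver.solve-∀

sumℤ-filter : ∀ {A : Set} {P : A → Set} (P? : Decidable P) (f : A → ℤ) as →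
  sumℤ (List.map f (List.filter P? as)) ≡ sumℤ (List.map (λ a → if does (P? a) then f a else ℤ.+ 0) as)
sumℤ-filter P? f [] = refl
sumℤ-filter P? f (a ∷ as) with does (P? a)
... | true  = cong (ℤ._+_ (f a)) (sumℤ-filter P? f as)
... | false = trans (sumℤ-filter P? f as) (sym (ℤP.+-identityˡ (sumℤ (List.map (λ a → if does (P? a) then f a else ℤ.+ 0) as))))

sumSubsets-suc : ∀ {n} (f : Subset (suc n) → ℤ) →
  sumSubsets (suc n) f ≡ sumSubsets n (λ X → f (outside ∷ X) ℤ.+ f (inside ∷ X))
sumSubsets-suc {n} f = go (allSubsets n)
  where
  go : ∀ Xs → sumℤ (List.map f (List.concatMap (λ s → (outside ∷ s) ∷ (inside ∷ s) ∷ []) Xs))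
    ≡ sumℤ (List.map (λ X → f (outside ∷ X) ℤ.+ f (inside ∷ X)) Xs)
  go []       = refl
  go (X ∷ Xs) = trans (cong (λ z → f (outside ∷ X) ℤ.+ (f (inside ∷ X) ℤ.+ z)) (go Xs))
    (sym (ℤP.+-assoc (f (outside ∷ X)) (f (inside ∷ X)) (sumℤ (List.map (λ X → f (outside ∷ X) ℤ.+ f (inside ∷ X)) Xs))))

-- The condition that `X` avoids `A` becomes a zero factor, so that sums run over all subsets and
-- split coordinate by coordinate.
disjointSign : ∀ {n} → Subset n → Subset n → ℤ
disjointSign A X = if does (X ⊆? ∁ A) then sign ∣ X ∣ else ℤ.+ 0

contains : ∀ {n} → Subset n → Subset n → ℤ
contains K A = bitℤ (does (K ⊆? A))

-- Signed sum over all `A` above `K` and all `X` disjoint from `A`. `H` is arbitrary because peeling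
-- off a coordinate replaces it by a combination of its restrictions.
disjointSum : ∀ {n} → Subset n → (Subset n → Subset n → ℤ) → ℤ
disjointSum {n} K H = sumSubsets n (λ A → contains K A ℤ.* sumSubsets n (λ X → disjointSign A X ℤ.* H A X))

disjointSum-cong : ∀ {n} (K : Subset n) {H H′ : Subset n → Subset n → ℤ} → (∀ A X → H A X ≡ H′ A X) →
  disjointSum K H ≡ disjointSum K H′
disjointSum-cong {n} K H≡H′ = sumℤ-cong (λ A → cong (contains K A ℤ.*_)
  (sumℤ-cong (λ X → cong (disjointSign A X ℤ.*_) (H≡H′ A X)) (allSubsets n))) (allSubsets n)

disjointSign-inside : ∀ {n} (A X : Subset n) → disjointSign (outside ∷ A) (inside ∷ X) ≡ ℤ.- disjointSign A X
disjointSign-inside A X with does (X ⊆? ∁ A)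
... | true  = ℤP.-1*i≡-i (sign ∣ X ∣)
... | false = refl

module _ {n} (H : Subset (suc n) → Subset (suc n) → ℤ) where

  private
    inner : Subset (suc n) → ℤ
    inner A = sumSubsets (suc n) (λ X → disjointSign A X ℤ.* H A X)

    sumWith : Subset n → (Subset n → ℤ) → ℤ
    sumWith A f = sumSubsets n (λ X → disjointSign A X ℤ.* f X)

    sumWith-lin : ∀ A c d (f g : Subset n → ℤ) →
      sumWith A (λ X → c ℤ.* f X ℤ.+ d ℤ.* g X) ≡ c ℤ.* sumWith A f ℤ.+ d ℤ.* sumWith A g
    sumWith-lin A c d f g = trans
      (sumℤ-cong (λ X → shuffle (disjointSign A X) c d (f X) (g X)) (allSubsets n))
      (sumℤ-lin c d (λ X → disjointSign A X ℤ.* f X) (λ X → disjointSign A X ℤ.* g X) (allSubsets n))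
      where
      shuffle : ∀ w c d x y → w ℤ.* (c ℤ.* x ℤ.+ d ℤ.* y) ≡ c ℤ.* (w ℤ.* x) ℤ.+ d ℤ.* (w ℤ.* y)
      shuffle = ℤ-Solver.solve-∀

    inner-inside : ∀ A → inner (inside ∷ A) ≡ sumWith A (λ X → H (inside ∷ A) (outside ∷ X))
    inner-inside A = trans (sumSubsets-suc (λ X → disjointSign (inside ∷ A) X ℤ.* H (inside ∷ A) X))
      (sumℤ-cong (λ X → drop (disjointSign A X ℤ.* H (inside ∷ A) (outside ∷ X)) (H (inside ∷ A) (inside ∷ X))) (allSubsets n))
      where
      drop : ∀ p q → p ℤ.+ (ℤ.+ 0) ℤ.* q ≡ p
      drop = ℤ-Solver.solve-∀

    inner-outside : ∀ A → inner (outside ∷ A) ≡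
      sumWith A (λ X → H (outside ∷ A) (outside ∷ X) ℤ.- H (outside ∷ A) (inside ∷ X))
    inner-outside A = trans (sumSubsets-suc (λ X → disjointSign (outside ∷ A) X ℤ.* H (outside ∷ A) X))
      (sumℤ-cong (λ X → trans
        (cong (λ w → disjointSign A X ℤ.* H (outside ∷ A) (outside ∷ X) ℤ.+ w ℤ.* H (outside ∷ A) (inside ∷ X)) (disjointSign-inside A X))
        (regroup (disjointSign A X) (H (outside ∷ A) (outside ∷ X)) (H (outside ∷ A) (inside ∷ X)))) (allSubsets n))
      where
      regroup : ∀ w p q → w ℤ.* p ℤ.+ (ℤ.- w) ℤ.* q ≡ w ℤ.* (p ℤ.- q)
      regroup = ℤ-Solver.solve-∀

  -- An `A` above `K` must contain the first element, and then `X` must omit it.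
  disjointSum-inside : ∀ K → disjointSum (inside ∷ K) H ≡ disjointSum K (λ A X → H (inside ∷ A) (outside ∷ X))
  disjointSum-inside K = trans (sumSubsets-suc (λ A → contains (inside ∷ K) A ℤ.* inner A))
    (sumℤ-cong (λ A → trans (drop (inner (outside ∷ A)) (contains K A ℤ.* inner (inside ∷ A)))
      (cong (contains K A ℤ.*_) (inner-inside A))) (allSubsets n))
    where
    drop : ∀ p q → (ℤ.+ 0) ℤ.* p ℤ.+ q ≡ q
    drop = ℤ-Solver.solve-∀

  -- The first element lies in neither set, in `X` (which flips the sign), or in `A`: hence three
  -- terms. The unit coefficients fit the shape of `sumWith-lin`.
  disjointSum-outside : ∀ K → disjointSum (outside ∷ K) H ≡
    disjointSum K (λ A X → (ℤ.+ 1) ℤ.* (H (outside ∷ A) (outside ∷ X) ℤ.- H (outside ∷ A) (inside ∷ X))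
      ℤ.+ (ℤ.+ 1) ℤ.* H (inside ∷ A) (outside ∷ X))
  disjointSum-outside K = trans (sumSubsets-suc (λ A → contains (outside ∷ K) A ℤ.* inner A))
    (sumℤ-cong (λ A → begin
      contains K A ℤ.* inner (outside ∷ A) ℤ.+ contains K A ℤ.* inner (inside ∷ A)
        ≡⟨ cong₂ (λ p q → contains K A ℤ.* p ℤ.+ contains K A ℤ.* q) (inner-outside A) (inner-inside A) ⟩
      contains K A ℤ.* P A ℤ.+ contains K A ℤ.* Q A
        ≡⟨ factor (contains K A) (P A) (Q A) ⟩
      contains K A ℤ.* ((ℤ.+ 1) ℤ.* P A ℤ.+ (ℤ.+ 1) ℤ.* Q A)
        ≡⟨ cong (contains K A ℤ.*_) (sumWith-lin A (ℤ.+ 1) (ℤ.+ 1)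
             (λ X → H (outside ∷ A) (outside ∷ X) ℤ.- H (outside ∷ A) (inside ∷ X)) (λ X → H (inside ∷ A) (outside ∷ X))) ⟨
      contains K A ℤ.* sumWith A (λ X → (ℤ.+ 1) ℤ.* (H (outside ∷ A) (outside ∷ X) ℤ.- H (outside ∷ A) (inside ∷ X))
        ℤ.+ (ℤ.+ 1) ℤ.* H (inside ∷ A) (outside ∷ X)) ∎) (allSubsets n))
    where
    open ≡-Reasoning
    P Q : Subset n → ℤ
    P A = sumWith A (λ X → H (outside ∷ A) (outside ∷ X) ℤ.- H (outside ∷ A) (inside ∷ X))
    Q A = sumWith A (λ X → H (inside ∷ A) (outside ∷ X))
    factor : ∀ e p q → e ℤ.* p ℤ.+ e ℤ.* q ≡ e ℤ.* ((ℤ.+ 1) ℤ.* p ℤ.+ (ℤ.+ 1) ℤ.* q)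
    factor = ℤ-Solver.solve-∀

-- At an element outside `K` the three terms telescope: (h₀ - g₀) - (h₁ - g₀) + (h₁ - g₁) = h₀ - g₁.
-- The recursive call thus restricts `h` to sets without the element and `g` to sets with it, so the
-- two must be separate functions even though both are later the rank.
möbius : ∀ {n} (h g : Subset n → ℤ) K → disjointSum K (λ A X → h (X ∪ A) ℤ.- g A) ≡ h K ℤ.- g ⊤
möbius h g [] = units (h []) (g [])
  where
  units : ∀ a b → (ℤ.+ 1) ℤ.* ((ℤ.+ 1) ℤ.* (a ℤ.- b) ℤ.+ (ℤ.+ 0)) ℤ.+ (ℤ.+ 0) ≡ a ℤ.- b
  units = ℤ-Solver.solve-∀
möbius h g (inside ∷ K) = trans (disjointSum-inside (λ A X → h (X ∪ A) ℤ.- g A) K)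
  (möbius (λ X → h (inside ∷ X)) (λ X → g (inside ∷ X)) K)
möbius h g (outside ∷ K) = trans (disjointSum-outside (λ A X → h (X ∪ A) ℤ.- g A) K)
  (trans (disjointSum-cong K (λ A X → collapse (h (outside ∷ (X ∪ A))) (h (inside ∷ (X ∪ A))) (g (outside ∷ A)) (g (inside ∷ A))))
    (möbius (λ X → h (outside ∷ X)) (λ X → g (inside ∷ X)) K))
  where
  collapse : ∀ h₀ h₁ g₀ g₁ → (ℤ.+ 1) ℤ.* ((h₀ ℤ.- g₀) ℤ.- (h₁ ℤ.- g₀)) ℤ.+ (ℤ.+ 1) ℤ.* (h₁ ℤ.- g₁) ≡ h₀ ℤ.- g₁
  collapse = ℤ-Solver.solve-∀

-- Beta invariants of contractions

sign*sign : ∀ k → sign k ℤ.* sign k ≡ ℤ.+ 1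
sign*sign zero    = refl
sign*sign (suc k) = trans (square (sign k)) (sign*sign k)
  where
  square : ∀ s → (ℤ.- (ℤ.+ 1) ℤ.* s) ℤ.* (ℤ.- (ℤ.+ 1) ℤ.* s) ≡ s ℤ.* s
  square = ℤ-Solver.solve-∀

-- The two rank signs differ by one in the exponent, so their product is -1 whatever the rank.
β̃-unsigned : ∀ {n} (S : Subset n) ρ → β̃ S ρ ≡
  ℤ.- sumℤ (List.map (λ X → sign ∣ X ∣ ℤ.* ℤ.+ ρ X) (List.filter (_⊆? S) (allSubsets n)))
β̃-unsigned {n} S ρ = trans (regroup (sign (ρ S)) Σ) (trans (cong (λ z → ℤ.- (z ℤ.* Σ)) (sign*sign (ρ S))) (cong ℤ.-_ (ℤP.*-identityˡ Σ)))
  where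
  Σ = sumℤ (List.map (λ X → sign ∣ X ∣ ℤ.* ℤ.+ ρ X) (List.filter (_⊆? S) (allSubsets n)))
  regroup : ∀ s z → (ℤ.- (ℤ.+ 1) ℤ.* s) ℤ.* (s ℤ.* z) ≡ ℤ.- ((s ℤ.* s) ℤ.* z)
  regroup = ℤ-Solver.solve-∀

meets-∁ : ∀ {n} (A K : Subset n) → meets (∁ A) K ≡ not (does (K ⊆? A))
meets-∁ []            []            = refl
meets-∁ (outside ∷ A) (outside ∷ K) = meets-∁ A K
meets-∁ (outside ∷ A) (inside  ∷ K) = refl
meets-∁ (inside  ∷ A) (outside ∷ K) = meets-∁ A K
meets-∁ (inside  ∷ A) (inside  ∷ K) = meets-∁ A K

contains-⊥ : ∀ {n} (A : Subset n) → contains ⊥ A ≡ ℤ.+ 1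
contains-⊥ []      = refl
contains-⊥ (_ ∷ A) = contains-⊥ A

module _ {n} (M : Matroid n) where

  private
    ρ : Subset n → ℤ
    ρ X = ℤ.+ r M X

    -- Monotonicity of the rank makes the truncated subtraction exact.
    contractRank-diff : ∀ A X → ℤ.+ contractRank M A X ≡ ρ (X ∪ A) ℤ.- ρ A
    contractRank-diff A X = sym (trans (ℤP.m-n≡m⊖n (r M (X ∪ A)) (r M A)) (ℤP.⊖-≥ (r-mono M (q⊆p∪q X A))))

  β̃/-sum : ∀ A → β̃/ M A ≡ ℤ.- sumSubsets n (λ X → disjointSign A X ℤ.* (ρ (X ∪ A) ℤ.- ρ A))
  β̃/-sum A = trans (β̃-unsigned (∁ A) (contractRank M A)) (cong ℤ.-_
    (trans (sumℤ-filter (_⊆? ∁ A) (λ X → sign ∣ X ∣ ℤ.* ℤ.+ contractRank M A X) (allSubsets n))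
      (sumℤ-cong pointwise (allSubsets n))))
    where
    pointwise : ∀ X → (if does (X ⊆? ∁ A) then sign ∣ X ∣ ℤ.* ℤ.+ contractRank M A X else ℤ.+ 0)
      ≡ disjointSign A X ℤ.* (ρ (X ∪ A) ℤ.- ρ A)
    pointwise X with does (X ⊆? ∁ A)
    ... | true  = cong (sign ∣ X ∣ ℤ.*_) (contractRank-diff A X)
    ... | false = sym (ℤP.*-zeroˡ (ρ (X ∪ A) ℤ.- ρ A))

  β̃/-above : ∀ K → sumSubsets n (λ A → contains K A ℤ.* β̃/ M A) ≡ ρ ⊤ ℤ.- ρ K
  β̃/-above K = begin
    sumSubsets n (λ A → contains K A ℤ.* β̃/ M A)
      ≡⟨ sumℤ-cong (λ A → trans (cong (contains K A ℤ.*_) (β̃/-sum A)) (expand (contains K A) (Σ A))) (allSubsets n) ⟩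
    -- The vanishing second summand only brings the sum into the form of `sumℤ-lin`.
    sumSubsets n (λ A → ℤ.- (ℤ.+ 1) ℤ.* (contains K A ℤ.* Σ A) ℤ.+ ℤ.+ 0 ℤ.* ℤ.+ 0)
      ≡⟨ sumℤ-lin (ℤ.- (ℤ.+ 1)) (ℤ.+ 0) (λ A → contains K A ℤ.* Σ A) (λ _ → ℤ.+ 0) (allSubsets n) ⟩
    ℤ.- (ℤ.+ 1) ℤ.* disjointSum K (λ A X → ρ (X ∪ A) ℤ.- ρ A) ℤ.+ ℤ.+ 0 ℤ.* sumSubsets n (λ _ → ℤ.+ 0)
      ≡⟨ cong (λ z → ℤ.- (ℤ.+ 1) ℤ.* z ℤ.+ ℤ.+ 0 ℤ.* sumSubsets n (λ _ → ℤ.+ 0)) (möbius ρ ρ K) ⟩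
    ℤ.- (ℤ.+ 1) ℤ.* (ρ K ℤ.- ρ ⊤) ℤ.+ ℤ.+ 0 ℤ.* sumSubsets n (λ _ → ℤ.+ 0)
      ≡⟨ flip (ρ K) (ρ ⊤) (sumSubsets n (λ _ → ℤ.+ 0)) ⟩
    ρ ⊤ ℤ.- ρ K ∎
    where
    open ≡-Reasoning
    Σ : Subset n → ℤ
    Σ A = sumSubsets n (λ X → disjointSign A X ℤ.* (ρ (X ∪ A) ℤ.- ρ A))
    expand : ∀ e z → e ℤ.* (ℤ.- z) ≡ ℤ.- (ℤ.+ 1) ℤ.* (e ℤ.* z) ℤ.+ (ℤ.+ 0) ℤ.* (ℤ.+ 0)
    expand = ℤ-Solver.solve-∀
    flip : ∀ a b z → ℤ.- (ℤ.+ 1) ℤ.* (a ℤ.- b) ℤ.+ (ℤ.+ 0) ℤ.* z ≡ b ℤ.- a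
    flip = ℤ-Solver.solve-∀

  β̃/-total : sumSubsets n (β̃/ M) ≡ ρ ⊤
  β̃/-total = begin
    sumSubsets n (β̃/ M)
      ≡⟨ sumℤ-cong (λ A → sym (trans (cong (ℤ._* β̃/ M A) (contains-⊥ A)) (ℤP.*-identityˡ (β̃/ M A)))) (allSubsets n) ⟩
    sumSubsets n (λ A → contains ⊥ A ℤ.* β̃/ M A)   ≡⟨ β̃/-above ⊥ ⟩
    ρ ⊤ ℤ.- ρ ⊥                                    ≡⟨ cong (λ k → ρ ⊤ ℤ.- ℤ.+ k) (r-⊥ M) ⟩
    ρ ⊤ ℤ.- ℤ.+ 0                                  ≡⟨ ℤP.+-identityʳ (ρ ⊤) ⟩
    ρ ⊤ ∎
    where open ≡-Reasoning

  -- If `K` contains the slack, every term counts and the total is the full rank. Otherwise `∁ A`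
  -- meets `K` unless `K ⊆ A`, so the sum over all `A` above `K`, which is `ρ ⊤ - ρ K`, is
  -- subtracted from `ρ ⊤`.
  coneRank-expansion : ∀ K → sumSubsets n (λ A → β̃/ M A ℤ.* bitℤ (meets (inside ∷ ∁ A) K)) ≡ ℤ.+ coneRank M K
  coneRank-expansion (inside ∷ K) =
    trans (sumℤ-cong (λ A → ℤP.*-identityʳ (β̃/ M A)) (allSubsets n)) β̃/-total
  coneRank-expansion (outside ∷ K) = begin
    sumSubsets n (λ A → β̃/ M A ℤ.* bitℤ (meets (∁ A) K))
      ≡⟨ sumℤ-cong (λ A → trans (cong (λ b → β̃/ M A ℤ.* bitℤ b) (meets-∁ A K)) (complement (β̃/ M A) (does (K ⊆? A)))) (allSubsets n) ⟩
    sumSubsets n (λ A → ℤ.+ 1 ℤ.* β̃/ M A ℤ.+ ℤ.- (ℤ.+ 1) ℤ.* (contains K A ℤ.* β̃/ M A))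
      ≡⟨ sumℤ-lin (ℤ.+ 1) (ℤ.- (ℤ.+ 1)) (β̃/ M) (λ A → contains K A ℤ.* β̃/ M A) (allSubsets n) ⟩
    ℤ.+ 1 ℤ.* sumSubsets n (β̃/ M) ℤ.+ ℤ.- (ℤ.+ 1) ℤ.* sumSubsets n (λ A → contains K A ℤ.* β̃/ M A)
      ≡⟨ cong₂ (λ p q → ℤ.+ 1 ℤ.* p ℤ.+ ℤ.- (ℤ.+ 1) ℤ.* q) β̃/-total (β̃/-above K) ⟩
    ℤ.+ 1 ℤ.* ρ ⊤ ℤ.+ ℤ.- (ℤ.+ 1) ℤ.* (ρ ⊤ ℤ.- ρ K)
      ≡⟨ cancel (ρ ⊤) (ρ K) ⟩
    ρ K ∎
    where
    open ≡-Reasoning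
    complement : ∀ z b → z ℤ.* bitℤ (not b) ≡ ℤ.+ 1 ℤ.* z ℤ.+ ℤ.- (ℤ.+ 1) ℤ.* (bitℤ b ℤ.* z)
    complement z true = at-true z
      where
      at-true : ∀ z → z ℤ.* (ℤ.+ 0) ≡ (ℤ.+ 1) ℤ.* z ℤ.+ ℤ.- (ℤ.+ 1) ℤ.* ((ℤ.+ 1) ℤ.* z)
      at-true = ℤ-Solver.solve-∀
    complement z false = at-false z
      where
      at-false : ∀ z → z ℤ.* (ℤ.+ 1) ≡ (ℤ.+ 1) ℤ.* z ℤ.+ ℤ.- (ℤ.+ 1) ℤ.* ((ℤ.+ 0) ℤ.* z)
      at-false = ℤ-Solver.solve-∀
    cancel : ∀ a b → (ℤ.+ 1) ℤ.* a ℤ.+ ℤ.- (ℤ.+ 1) ℤ.* (a ℤ.- b) ≡ b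
    cancel = ℤ-Solver.solve-∀

-- Separating the coefficients by sign

sumℚ : List ℚ → ℚ
sumℚ = List.foldr _+_ 0ℚ

toℚ-*-bit : ∀ z b → toℚ (z ℤ.* bitℤ b) ≡ toℚ z * bit b
toℚ-*-bit z true  = trans (cong toℚ (ℤP.*-identityʳ z)) (sym (*-identityʳ (toℚ z)))
toℚ-*-bit z false = trans (cong toℚ (ℤP.*-zeroʳ z)) (sym (*-zeroʳ (toℚ z)))

module _ {A : Set} (b : A → ℤ) (g : A → Bool) where

  private
    positive? : Decidable (λ a → ℤ.+ 0 ℤ.< b a)
    positive? a = ℤ.+ 0 ℤP.<? b a

    negative? : Decidable (λ a → b a ℤ.< ℤ.+ 0)
    negative? a = b a ℤP.<? ℤ.+ 0

    posTerm negTerm : A → ℚ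
    posTerm a = toℚ (b a) * bit (g a)
    negTerm a = toℚ (ℤ.- b a) * bit (g a)

    positives negatives : List A → ℚ
    positives as = sumℚ (List.map posTerm (List.filter positive? as))
    negatives as = sumℚ (List.map negTerm (List.filter negative? as))

    total : List A → ℤ
    total as = sumℤ (List.map (λ a → b a ℤ.* bitℤ (g a)) as)

    total-∷ : ∀ a as → toℚ (total (a ∷ as)) ≡ toℚ (b a) * bit (g a) + toℚ (total as)
    total-∷ a as = trans (toℚ-+ (b a ℤ.* bitℤ (g a)) (total as)) (cong (_+ toℚ (total as)) (toℚ-*-bit (b a) (g a)))

  -- A negative coefficient is cancelled by its negation in the second sum, a positive one appears
  -- on both sides, and a zero one is in neither filtered list and adds nothing to the total.
  split-signs : ∀ as → toℚ (sumℤ (List.map (λ a → b a ℤ.* bitℤ (g a)) as))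
      + sumℚ (List.map (λ a → toℚ (ℤ.- b a) * bit (g a)) (List.filter (λ a → b a ℤP.<? ℤ.+ 0) as))
    ≡ sumℚ (List.map (λ a → toℚ (b a) * bit (g a)) (List.filter (λ a → ℤ.+ 0 ℤP.<? b a) as))
  split-signs [] = refl
  split-signs (a ∷ as) with ℤP.<-cmp (b a) (ℤ.+ 0)
  ... | tri< neg _ ¬pos
    rewrite filter-accept negative? {xs = as} neg | filter-reject positive? {xs = as} ¬pos | total-∷ a as | toℚ-neg (b a) =
    trans (cancel (toℚ (b a)) (bit (g a)) (toℚ (total as)) (negatives as)) (split-signs as)
    where
    cancel : ∀ p q t u → (p * q + t) + ((- p) * q + u) ≡ t + u
    cancel = solve-∀ ℚ-ring
  ... | tri> ¬neg _ pos
    rewrite filter-reject negative? {xs = as} ¬neg | filter-accept positive? {xs = as} pos | total-∷ a as =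
    trans (+-assoc (posTerm a) (toℚ (total as)) (negatives as)) (cong (posTerm a +_) (split-signs as))
  ... | tri≈ ¬neg b≡0 ¬pos
    rewrite filter-reject negative? {xs = as} ¬neg | filter-reject positive? {xs = as} ¬pos | total-∷ a as | b≡0 =
    trans (cancel (bit (g a)) (toℚ (total as)) (negatives as)) (split-signs as)
    where
    cancel : ∀ q t u → (0ℚ * q + t) + u ≡ t + u
    cancel = solve-∀ ℚ-ring

-- The two sides of the Minkowski identity

module _ {n} (M : Matroid n) where

  positiveSide-presents : Presents (positiveSide M) (λ K → sumℚ (List.map
    (λ A → toℚ (β̃/ M A) * bit (meets (inside ∷ ∁ A) K)) (List.filter (λ A → ℤ.+ 0 ℤP.<? β̃/ M A) (allSubsets n))))
  positiveSide-presents = ⨁-presents (All.map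
    (λ {A} pos → ·-presents (toℚ-mono (ℤP.<⇒≤ pos)) (D-presents (∁ A)))
    (all-filter (λ A → ℤ.+ 0 ℤP.<? β̃/ M A) (allSubsets n)))

  negativeSide-presents : Presents (negativeSide M) (λ K → sumℚ (List.map
    (λ A → toℚ (ℤ.- β̃/ M A) * bit (meets (inside ∷ ∁ A) K)) (List.filter (λ A → β̃/ M A ℤP.<? ℤ.+ 0) (allSubsets n))))
  negativeSide-presents = ⨁-presents (All.map
    (λ {A} neg → ·-presents (toℚ-mono (ℤP.<⇒≤ (ℤP.neg-mono-< neg))) (D-presents (∁ A)))
    (all-filter (λ A → β̃/ M A ℤP.<? ℤ.+ 0) (allSubsets n)))

  sides-agree : ∀ K → rankFunction M K + sumℚ (List.map
      (λ A → toℚ (ℤ.- β̃/ M A) * bit (meets (inside ∷ ∁ A) K)) (List.filter (λ A → β̃/ M A ℤP.<? ℤ.+ 0) (allSubsets n)))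
    ≡ sumℚ (List.map
      (λ A → toℚ (β̃/ M A) * bit (meets (inside ∷ ∁ A) K)) (List.filter (λ A → ℤ.+ 0 ℤP.<? β̃/ M A) (allSubsets n)))
  sides-agree K = trans
    (cong (λ z → toℚ z + sumℚ (List.map
      (λ A → toℚ (ℤ.- β̃/ M A) * bit (meets (inside ∷ ∁ A) K)) (List.filter (λ A → β̃/ M A ℤP.<? ℤ.+ 0) (allSubsets n))))
      (sym (coneRank-expansion M K)))
    (split-signs (β̃/ M) (λ A → meets (inside ∷ ∁ A) K) (allSubsets n))

theorem4p4 : (n : ℕ) (M : Matroid n) (x : Point n) →
    ((IM M ⊕ negativeSide M) x → positiveSide M x) ×
    (positiveSide M x → (IM M ⊕ negativeSide M) x)
theorem4p4 n M x =
  presents-⊆ lhs (positiveSide-presents M) (sides-agree M) ,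
  presents-⊆ (positiveSide-presents M) lhs (λ K → sym (sides-agree M K))
  where
  lhs = ⊕-presents (IM-presents M) (negativeSide-presents M)
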